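{- A line graph is joined a-perfect if and only if it is h-perfect.
   Context: A line graph is a graph $L(H)$ whose nodes are the edges of a graph $H$ (parallel edges allowed), two adjacent iff they share an endnode. ${\rm STAB}(G)$ is the convex hull of incidence vectors of stable sets of $G$; $\alpha(G')$ is the maximum size of a stable set of $G'$; $x(S)=\sum_{i\in S}x_i$. The antiweb $A^k_n$ has nodes $0,\dots,n-1$ and edges $ij$ ($i\ne j$) iff $k\le|i-j|\le n-k$. The complete join of graphs is their disjoint union with all edges between different parts added. A joined antiweb constraint of $G$ is an inequality $\sum_{i\le t}\frac{1}{\alpha(A_i)}x(A_i)+x(Q)\le1$, where $A_1,\dots,A_t$ are antiwebs and $Q$ is a clique such that their complete join is an induced subgraph of $G$. ${\rm ASTAB}^*(G)$ is the set of nonnegative $x$ satisfying all joined antiweb constraints of $G$, and $G$ is joined a-perfect if ${\rm STAB}(G)={\rm ASTAB}^*(G)$. $G$ is h-perfect if ${\rm STAB}(G)$ equals the set of $x\ge0$ satisfying $x(Q)\le1$ for every clique $Q$ and $x(C)\le k$ for every odd hole (chordless cycle) $C$ of $G$ on $2k+1\ge5$ nodes.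
   Formalization: The points x and the convex-combination weights are rational: STAB(G), ASTAB*(G) and the h-perfection polytope are compared on rational vectors only; as all three are rational polyhedra, this is equivalent to equality over the reals. -}

module Defs where

open import Data.Bool using (Bool; true; false; _∧_; _∨_; if_then_else_)
open import Data.Nat as ℕ using (ℕ; zero; suc; _∸_; _≤ᵇ_; _≡ᵇ_; _%_; ∣_-_∣)
open import Data.Fin using (Fin; toℕ; _≟_)
open import Data.Integer using (+_)
open import Data.Rational using (ℚ; 0ℚ; 1ℚ; _+_; _*_; _≤_; _/_)
open import Data.List using (List; []; _∷_; foldr; map)
open import Data.List.Relation.Unary.All using (All)
open import Data.Product using (Σ; ∃; _×_; _,_; proj₁; proj₂)
open import Data.Sum using (_⊎_; inj₁; inj₂)
open import Relation.Nullary using (¬_; yes; no)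
open import Relation.Nullary.Decidable using (⌊_⌋)
open import Relation.Binary.PropositionalEquality using (_≡_; _≢_; refl)
open import Function using (Injective)

record Graph (n : ℕ) : Set where
  field
    adj    : Fin n → Fin n → Bool
    sym    : ∀ i j → adj i j ≡ adj j i
    irrefl : ∀ i → adj i i ≡ false
open Graph public

Σℚ : (n : ℕ) → (Fin n → ℚ) → ℚ
Σℚ zero    f = 0ℚ
Σℚ (suc n) f = f Data.Fin.zero + Σℚ n (λ i → f (Data.Fin.suc i))

size : ∀ {n} → (Fin n → Bool) → ℕ
size {zero}  S = 0
size {suc n} S = (if S Data.Fin.zero then 1 else 0) ℕ.+ size (λ i → S (Data.Fin.suc i))

χ : ∀ {n} → (Fin n → Bool) → Fin n → ℚ
χ S i = if S i then 1ℚ else 0ℚ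

xOf : ∀ {n} → (Fin n → ℚ) → (Fin n → Bool) → ℚ
xOf {n} x S = Σℚ n (λ i → χ S i * x i)

Stable : ∀ {n} → (Fin n → Fin n → Bool) → (Fin n → Bool) → Set
Stable adjc S = ∀ i j → i ≢ j → S i ≡ true → S j ≡ true → adjc i j ≡ false

IsClique : ∀ {n} → Graph n → (Fin n → Bool) → Set
IsClique G Q = ∀ i j → i ≢ j → Q i ≡ true → Q j ≡ true → adj G i j ≡ true

IsAlpha : ∀ {n} → (Fin n → Fin n → Bool) → ℕ → Set
IsAlpha adjc a =
  (Σ _ λ S → Stable adjc S × size S ≡ a) ×
  (∀ S → Stable adjc S → size S ℕ.≤ a)

InSTAB : ∀ {n} → Graph n → (Fin n → ℚ) → Set
InSTAB {n} G x =
  Σ (List (ℚ × (Fin n → Bool))) λ L →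
    All (λ p → (0ℚ ≤ proj₁ p) × Stable (adj G) (proj₂ p)) L ×
    (foldr (λ p s → proj₁ p + s) 0ℚ L ≡ 1ℚ) ×
    (∀ i → x i ≡ foldr (λ p s → proj₁ p * χ (proj₂ p) i + s) 0ℚ L)

antiwebAdj : (m k : ℕ) → Fin m → Fin m → Bool
antiwebAdj m k a b =
  let d = ∣ toℕ a - toℕ b ∣ in
  (if ⌊ a ≟ b ⌋ then false else true) ∧ (k ≤ᵇ d) ∧ (d ≤ᵇ (m ∸ k))

-- Data of a complete join of antiwebs A_1..A_t and a clique Q
-- (of size q) occurring as an induced subgraph of G.
-- Antiweb i is A^{k i}_{m i}; its stability number is suc (αp i).
record JoinedAntiweb {n : ℕ} (G : Graph n) : Set where
  field
    t   : ℕ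
    m   : Fin t → ℕ
    k   : Fin t → ℕ
    m≥1 : ∀ i → 1 ℕ.≤ m i
    k≥1 : ∀ i → 1 ℕ.≤ k i
    αp  : Fin t → ℕ
    isα : ∀ i → IsAlpha (antiwebAdj (m i) (k i)) (suc (αp i))
    q   : ℕ
    emb : (Σ (Fin t) (λ i → Fin (m i))) ⊎ Fin q → Fin n
    emb-inj : Injective _≡_ _≡_ emb
    emb-antiweb : ∀ i a b → a ≢ b →
      adj G (emb (inj₁ (i , a))) (emb (inj₁ (i , b))) ≡ antiwebAdj (m i) (k i) a b
    emb-across : ∀ i j a b → i ≢ j →
      adj G (emb (inj₁ (i , a))) (emb (inj₁ (j , b))) ≡ true
    emb-AQ : ∀ i a c → adj G (emb (inj₁ (i , a))) (emb (inj₂ c)) ≡ true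
    emb-Q : ∀ c d → c ≢ d → adj G (emb (inj₂ c)) (emb (inj₂ d)) ≡ true

joinedLHS : ∀ {n} {G : Graph n} → JoinedAntiweb G → (Fin n → ℚ) → ℚ
joinedLHS J x =
  Σℚ t (λ i → ((+ 1) / suc (αp i)) * Σℚ (m i) (λ a → x (emb (inj₁ (i , a)))))
  + Σℚ q (λ c → x (emb (inj₂ c)))
  where open JoinedAntiweb J

InASTAB* : ∀ {n} → Graph n → (Fin n → ℚ) → Set
InASTAB* G x = (∀ i → 0ℚ ≤ x i) × (∀ (J : JoinedAntiweb G) → joinedLHS J x ≤ 1ℚ)

JoinedAPerfect : ∀ {n} → Graph n → Set
JoinedAPerfect G = ∀ x → (InSTAB G x → InASTAB* G x) × (InASTAB* G x → InSTAB G x)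

cycleAdj : (L : ℕ) → .{{_ : ℕ.NonZero L}} → Fin L → Fin L → Bool
cycleAdj L a b =
  (toℕ b ≡ᵇ ((suc (toℕ a)) % L)) ∨ (toℕ a ≡ᵇ ((suc (toℕ b)) % L))

record OddHole {n : ℕ} (G : Graph n) : Set where
  field
    k    : ℕ
    k≥2  : 2 ℕ.≤ k
    node : Fin (suc (2 ℕ.* k)) → Fin n
    node-inj : Injective _≡_ _≡_ node
    chordless : ∀ a b → a ≢ b →
      adj G (node a) (node b) ≡ cycleAdj (suc (2 ℕ.* k)) a b

InHSTAB : ∀ {n} → Graph n → (Fin n → ℚ) → Set
InHSTAB G x =
  (∀ i → 0ℚ ≤ x i) ×
  (∀ Q → IsClique G Q → xOf x Q ≤ 1ℚ) ×
  (∀ (C : OddHole G) →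
     Σℚ (suc (2 ℕ.* OddHole.k C)) (λ a → x (OddHole.node C a)) ≤ (+ OddHole.k C) / 1)

HPerfect : ∀ {n} → Graph n → Set
HPerfect G = ∀ x → (InSTAB G x → InHSTAB G x) × (InHSTAB G x → InSTAB G x)

-- Line graphs: G = L(H) for a loopless multigraph H on Fin h,
-- node e of G being an edge of H with endnodes ends e.

shareB : ∀ {h} → Fin h × Fin h → Fin h × Fin h → Bool
shareB (u , v) (u' , v') =
  ⌊ u ≟ u' ⌋ ∨ ⌊ u ≟ v' ⌋ ∨ ⌊ v ≟ u' ⌋ ∨ ⌊ v ≟ v' ⌋

IsLineGraph : ∀ {n} → Graph n → Set
IsLineGraph {n} G =
  Σ ℕ λ h → Σ (Fin n → Fin h × Fin h) λ ends →
    (∀ e → proj₁ (ends e) ≢ proj₂ (ends e)) ×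
    (∀ e f → e ≢ f → adj G e f ≡ shareB (ends e) (ends f))

{-# OPTIONS --safe #-}
module Submission where

-- STAB ⊆ ASTAB* ⊆ HSTAB holds for every graph: a stable set meets at most one part of a complete
-- join, cliques are joins without antiwebs, and the odd hole on 2k+1 nodes is the antiweb A^k_{2k+1}.
-- It remains that HSTAB ⊆ ASTAB* for line graphs. An antiweb that is an induced subgraph of a line
-- graph is either partitioned into at most α cliques or an odd hole, for otherwise it contains a claw
-- or the complement of P₆. An odd hole is joined to nothing else, since an edge cannot meet all edges
-- of a cycle of length ≥ 5; hence its constraint is an odd hole inequality. If all antiwebs are
-- partitioned, then choosing in each the heaviest clique of the partition bounds the joined
-- constraint by a clique inequality.

open import Defs
open import Data.Bool as Bool using (Bool; true; false; T; _∧_; _∨_; if_then_else_)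
open import Data.Bool.Properties using (⇔→≡; ¬-not; T-≡; ∨-zeroʳ)
open import Data.Empty using (⊥; ⊥-elim)
open import Data.Fin using (Fin; zero; suc; toℕ; _≟_; fromℕ<)
open import Data.Fin.Permutation using (Permutation; permutation; _⟨$⟩ʳ_)
open import Data.Fin.Properties using
  (suc-injective; injective⇒≤; toℕ-injective; toℕ<n; toℕ-fromℕ<; all?)
import Data.Integer as ℤ
import Data.Integer.Properties as ℤ
open import Data.List using (List; []; _∷_; _++_; foldr; map; filter; concat; tabulate; allFin)
open import Data.List.Relation.Unary.All as All using (All; []; _∷_)
import Data.List.Relation.Unary.All.Properties as All
open import Data.List.Relation.Unary.AllPairs as AllPairs using (AllPairs; []; _∷_)
import Data.List.Relation.Unary.AllPairs.Properties as AllPairs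
open import Data.Nat as ℕ using (ℕ; zero; suc; _∸_; _%_; ∣_-_∣; z≤n; s≤s; _≤ᵇ_; _<ᵇ_; _≡ᵇ_)
open import Data.Nat.DivMod using (m<n⇒m%n≡m; n%n≡0; m%n<n)
import Data.Nat.Properties as ℕ
open import Data.Product using (Σ; ∃; _×_; _,_; proj₁; proj₂)
open import Data.Rational using (ℚ; 0ℚ; 1ℚ; _+_; _*_; -_; _≤_; _/_; nonNegative; toℚᵘ)
import Data.Rational.Properties as ℚ
open import Algebra.Properties.CommutativeMonoid.Sum ℚ.+-0-commutativeMonoid using (sum; sum-permute)
open import Data.Rational.Solver using (module +-*-Solver)
import Data.Rational.Unnormalised as ℚᵘ
import Data.Rational.Unnormalised.Properties as ℚᵘ
open import Data.Sum as Sum using (_⊎_; inj₁; inj₂; [_,_]′)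
open import Function using (_∘_; id; mk⇔; Equivalence)
open import Function.Definitions using (Injective)
open import Relation.Binary.Definitions using (tri<; tri≈; tri>)
open import Relation.Binary.PropositionalEquality as ≡
  using (_≡_; _≢_; refl; trans; cong; cong₂; subst; subst₂)
open import Relation.Nullary using (¬_; yes; no; contradiction)
open import Relation.Nullary.Decidable using (⌊_⌋; from-yes; _→-dec_; ¬?)

open +-*-Solver using (solve; _:+_; _:*_; _:=_)

private
  variable
    n h : ℕ

-- Finite sums of rationals.

Σ-cong : ∀ n {f g : Fin n → ℚ} → (∀ i → f i ≡ g i) → Σℚ n f ≡ Σℚ n g
Σ-cong zero    eq = refl
Σ-cong (suc n) eq = cong₂ _+_ (eq zero) (Σ-cong n (eq ∘ suc))

Σ-zero : ∀ n {f : Fin n → ℚ} → (∀ i → f i ≡ 0ℚ) → Σℚ n f ≡ 0ℚ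
Σ-zero zero    eq = refl
Σ-zero (suc n) eq = trans (cong₂ _+_ (eq zero) (Σ-zero n (eq ∘ suc))) (ℚ.+-identityˡ 0ℚ)

Σ-mono-≤ : ∀ n {f g : Fin n → ℚ} → (∀ i → f i ≤ g i) → Σℚ n f ≤ Σℚ n g
Σ-mono-≤ zero    le = ℚ.≤-refl
Σ-mono-≤ (suc n) le = ℚ.+-mono-≤ (le zero) (Σ-mono-≤ n (le ∘ suc))

Σ-linear : ∀ n a (f g : Fin n → ℚ) → Σℚ n (λ i → a * f i + g i) ≡ a * Σℚ n f + Σℚ n g
Σ-linear zero    a f g = ≡.sym (trans (ℚ.+-identityʳ (a * 0ℚ)) (ℚ.*-zeroʳ a))
Σ-linear (suc n) a f g = trans
  (cong ((a * f zero + g zero) +_) (Σ-linear n a (f ∘ suc) (g ∘ suc)))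
  (solve 5 (λ a x y s r → (a :* x :+ y) :+ (a :* s :+ r) := a :* (x :+ s) :+ (y :+ r)) refl
     a (f zero) (g zero) (Σℚ n (f ∘ suc)) (Σℚ n (g ∘ suc)))

-- Serves inductions that insert one element: the indicator of a longer list, or the family of
-- colour classes, then changes at a single index.
Σ-update : ∀ {n} (f g : Fin n → ℚ) u v → f u ≡ v + g u → (∀ j → j ≢ u → f j ≡ g j) →
  Σℚ n f ≡ v + Σℚ n g
Σ-update {suc n} f g zero v at off = trans
  (cong₂ _+_ at (Σ-cong n (λ j → off (suc j) λ ())))
  (ℚ.+-assoc v (g zero) _)
Σ-update {suc n} f g (suc u) v at off = trans
  (cong₂ _+_ (off zero λ ()) (Σ-update (f ∘ suc) (g ∘ suc) u v at (λ j j≢u → off (suc j) (j≢u ∘ suc-injective))))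
  (solve 3 (λ x v s → x :+ (v :+ s) := v :+ (x :+ s)) refl (g zero) v (Σℚ n (g ∘ suc)))

Σ-sum : ∀ n (f : Fin n → ℚ) → Σℚ n f ≡ sum f
Σ-sum zero    f = refl
Σ-sum (suc n) f = cong (f zero +_) (Σ-sum n (f ∘ suc))

Σ-permute : ∀ {m n} (f : Fin n → ℚ) (π : Permutation m n) → Σℚ n f ≡ Σℚ m (f ∘ (π ⟨$⟩ʳ_))
Σ-permute {m} {n} f π = trans (Σ-sum n f) (trans (sum-permute f π) (≡.sym (Σ-sum m (f ∘ (π ⟨$⟩ʳ_)))))

-- Models a stable set meeting the parts of a complete join: a part that is hit contributes at most
-- 1, and no two parts are hit. The witness of the hit is returned so that the antiwebs can
-- afterwards be played off against the clique.
Σ-exclusive : ∀ n (f : Fin n → ℚ) (H : Fin n → Set) →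
  (∀ i → f i ≡ 0ℚ ⊎ (f i ≤ 1ℚ × H i)) → (∀ i j → H i → H j → i ≡ j) →
  Σℚ n f ≡ 0ℚ ⊎ (Σℚ n f ≤ 1ℚ × ∃ H)
Σ-exclusive zero    f H h excl = inj₁ refl
Σ-exclusive (suc n) f H h excl
  with h zero | Σ-exclusive n (f ∘ suc) (H ∘ suc) (h ∘ suc) (λ i j p q → suc-injective (excl _ _ p q))
... | inj₁ z       | inj₁ z'      = inj₁ (cong₂ _+_ z z')
... | inj₁ z       | inj₂ (l , i , p) =
  inj₂ (subst (_≤ 1ℚ) (≡.sym (trans (cong (_+ Σℚ n (f ∘ suc)) z) (ℚ.+-identityˡ (Σℚ n (f ∘ suc))))) l , suc i , p)
... | inj₂ (l , p) | inj₁ z'      =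
  inj₂ (subst (_≤ 1ℚ) (≡.sym (trans (cong (f zero +_) z') (ℚ.+-identityʳ (f zero)))) l , zero , p)
... | inj₂ (l , p) | inj₂ (_ , j , q) with () ← excl zero (suc j) p q

-- Natural numbers and their reciprocals in ℚ.

ℕ→ℚ : ℕ → ℚ
ℕ→ℚ zero    = 0ℚ
ℕ→ℚ (suc n) = 1ℚ + ℕ→ℚ n

-- On ℚ the quotient `_/_` normalises by a gcd and is stuck on a variable. Unnormalised fractions
-- compute, so the facts about quotients are proved there and carried back.
ℕ→ℚᵘ : ∀ n → toℚᵘ (ℕ→ℚ n) ℚᵘ.≃ (ℤ.+ n) ℚᵘ./ 1
ℕ→ℚᵘ zero    = ℚᵘ.*≡* refl
ℕ→ℚᵘ (suc n) = ℚᵘ.≃-trans (ℚ.toℚᵘ-homo-+ 1ℚ (ℕ→ℚ n))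
  (ℚᵘ.≃-trans (ℚᵘ.+-congʳ (toℚᵘ 1ℚ) (ℕ→ℚᵘ n)) (ℚᵘ.*≡* (cong (λ k → (ℤ.+ 1 ℤ.+ k) ℤ.* ℤ.+ 1) (ℤ.*-identityʳ (ℤ.+ n)))))

ℕ→ℚ≡/1 : ∀ n → ℕ→ℚ n ≡ (ℤ.+ n) / 1
ℕ→ℚ≡/1 n = ℚ.toℚᵘ-injective (ℚᵘ.≃-trans (ℕ→ℚᵘ n) (ℚᵘ.≃-sym (ℚ.toℚᵘ-fromℚᵘ ((ℤ.+ n) ℚᵘ./ 1))))

recip : ∀ p → ((ℤ.+ 1) / suc p) * ℕ→ℚ (suc p) ≡ 1ℚ
recip p = ℚ.toℚᵘ-injective (ℚᵘ.≃-trans (ℚ.toℚᵘ-homo-* ((ℤ.+ 1) / suc p) (ℕ→ℚ (suc p)))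
  (ℚᵘ.≃-trans (ℚᵘ.*-cong (ℚ.toℚᵘ-fromℚᵘ ((ℤ.+ 1) ℚᵘ./ suc p)) (ℕ→ℚᵘ (suc p)))
    (ℚᵘ.*≡* (cong (λ k → ℤ.+ suc k)
      (trans (ℕ.*-identityʳ (p ℕ.+ 0)) (≡.sym (trans (ℕ.+-identityʳ (p ℕ.* 1))
        (trans (ℕ.*-identityʳ p) (≡.sym (ℕ.+-identityʳ p))))))))))

recip≥0 : ∀ p → 0ℚ ≤ (ℤ.+ 1) / suc p
recip≥0 p = ℚ.toℚᵘ-cancel-≤ (ℚᵘ.≤-respʳ-≃ (ℚᵘ.≃-sym (ℚ.toℚᵘ-fromℚᵘ ((ℤ.+ 1) ℚᵘ./ suc p))) (ℚᵘ.*≤* (ℤ.+≤+ ℕ.z≤n)))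

0≤1 : 0ℚ ≤ 1ℚ
0≤1 = ℚ.nonNegative⁻¹ 1ℚ

*-monoʳ : ∀ {a x y} → 0ℚ ≤ a → x ≤ y → a * x ≤ a * y
*-monoʳ {a} 0≤a = ℚ.*-monoˡ-≤-nonNeg a {{nonNegative 0≤a}}

ℕ→ℚ-mono : ∀ {m n} → m ℕ.≤ n → ℕ→ℚ m ≤ ℕ→ℚ n
ℕ→ℚ-mono {n = zero}  ℕ.z≤n   = ℚ.≤-refl
ℕ→ℚ-mono {n = suc n} ℕ.z≤n   = ℚ.+-mono-≤ 0≤1 (ℕ→ℚ-mono {n = n} ℕ.z≤n)
ℕ→ℚ-mono             (ℕ.s≤s le) = ℚ.+-mono-≤ (ℚ.≤-refl {1ℚ}) (ℕ→ℚ-mono le)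

-- Multiplication by the reciprocal cancels the factor. `M` will be 1 or the weight of a heaviest
-- clique.
recip-≤ : ∀ p {y M} → y ≤ ℕ→ℚ (suc p) * M → ((ℤ.+ 1) / suc p) * y ≤ M
recip-≤ p {y} {M} le = subst (((ℤ.+ 1) / suc p) * y ≤_)
  (trans (≡.sym (ℚ.*-assoc ((ℤ.+ 1) / suc p) (ℕ→ℚ (suc p)) M)) (trans (cong (_* M) (recip p)) (ℚ.*-identityˡ M)))
  (*-monoʳ (recip≥0 p) le)

recip-≤1 : ∀ p {y} → y ≤ ℕ→ℚ (suc p) → ((ℤ.+ 1) / suc p) * y ≤ 1ℚ
recip-≤1 p le = recip-≤ p (subst (_ ≤_) (≡.sym (ℚ.*-identityʳ (ℕ→ℚ (suc p)))) le)

recip-≤1⁻¹ : ∀ p {y} → ((ℤ.+ 1) / suc p) * y ≤ 1ℚ → y ≤ ℕ→ℚ (suc p)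
recip-≤1⁻¹ p {y} le = subst₂ _≤_
  (trans (≡.sym (ℚ.*-assoc N R y)) (trans (cong (_* y) (trans (ℚ.*-comm N R) (recip p))) (ℚ.*-identityˡ y)))
  (ℚ.*-identityʳ N) (*-monoʳ (ℕ→ℚ-mono {0} {suc p} ℕ.z≤n) le)
  where
  N = ℕ→ℚ (suc p)
  R = (ℤ.+ 1) / suc p

Σ-≤-const : ∀ n (f : Fin n → ℚ) M → (∀ i → f i ≤ M) → Σℚ n f ≤ ℕ→ℚ n * M
Σ-≤-const zero    f M le = ℚ.≤-reflexive (≡.sym (ℚ.*-zeroˡ M))
Σ-≤-const (suc n) f M le = subst (Σℚ (suc n) f ≤_)
  (trans (cong (_+ ℕ→ℚ n * M) (≡.sym (ℚ.*-identityˡ M))) (≡.sym (ℚ.*-distribʳ-+ M 1ℚ (ℕ→ℚ n))))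
  (ℚ.+-mono-≤ (le zero) (Σ-≤-const n (f ∘ suc) M (le ∘ suc)))

-- Subsets of `Fin n`: cardinality and enumeration.

Σ-χ : ∀ n (S : Fin n → Bool) → Σℚ n (χ S) ≡ ℕ→ℚ (size S)
Σ-χ zero    S = refl
Σ-χ (suc n) S with S zero
... | true  = cong (1ℚ +_) (Σ-χ n (S ∘ suc))
... | false = trans (ℚ.+-identityˡ (Σℚ n (χ (S ∘ suc)))) (Σ-χ n (S ∘ suc))

size≡0⊎∃ : ∀ {n} (S : Fin n → Bool) → (∀ i → S i ≡ false) ⊎ ∃ λ i → S i ≡ true
size≡0⊎∃ {zero}  S = inj₁ λ ()
size≡0⊎∃ {suc n} S with S zero in eq | size≡0⊎∃ (S ∘ suc)
... | true  | _            = inj₂ (zero , eq)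
... | false | inj₂ (i , p) = inj₂ (suc i , p)
... | false | inj₁ none    = inj₁ λ { zero → eq ; (suc i) → none i }

enum : (S : Fin n → Bool) → Fin (size S) → Fin n
enum {suc n} S i with S zero
enum {suc n} S zero    | true  = zero
enum {suc n} S (suc i) | true  = suc (enum (S ∘ suc) i)
enum {suc n} S i       | false = suc (enum (S ∘ suc) i)

enum-∈ : (S : Fin n → Bool) → ∀ i → S (enum S i) ≡ true
enum-∈ {suc n} S i with S zero in eq
enum-∈ {suc n} S zero    | true  = eq
enum-∈ {suc n} S (suc i) | true  = enum-∈ (S ∘ suc) i
enum-∈ {suc n} S i       | false = enum-∈ (S ∘ suc) i

enum-injective : (S : Fin n → Bool) → Injective _≡_ _≡_ (enum S)
enum-injective {suc n} S {i} {j} eq with S zero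
enum-injective {suc n} S {zero}  {zero}  eq | true  = refl
enum-injective {suc n} S {suc i} {suc j} eq | true  =
  cong suc (enum-injective (S ∘ suc) (suc-injective eq))
enum-injective {suc n} S {i}     {j}     eq | false = enum-injective (S ∘ suc) (suc-injective eq)

xOf-enum : ∀ {n} (x : Fin n → ℚ) S → xOf x S ≡ Σℚ (size S) (x ∘ enum S)
xOf-enum {zero}  x S = refl
xOf-enum {suc n} x S with S zero
... | true  = cong₂ _+_ (ℚ.*-identityˡ (x zero)) (xOf-enum (x ∘ suc) (S ∘ suc))
... | false = trans (cong₂ _+_ (ℚ.*-zeroˡ (x zero)) (xOf-enum (x ∘ suc) (S ∘ suc)))
              (ℚ.+-identityˡ (Σℚ (size (S ∘ suc)) (x ∘ suc ∘ enum (S ∘ suc))))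

-- Pigeonhole principle, applied to `c` after `enum`. The map `c` may use the membership proof,
-- because in `α-bound` only members of `S` receive a value.
size-≤ : ∀ {n r} (S : Fin n → Bool) (c : ∀ a → S a ≡ true → Fin r) →
  (∀ {a b} p q → c a p ≡ c b q → a ≡ b) → size S ℕ.≤ r
size-≤ S c inj = injective⇒≤ {f = λ i → c (enum S i) (enum-∈ S i)}
  (λ eq → enum-injective S (inj _ _ eq))

-- Lists of nodes as sets and as cliques.

sumL : (Fin n → ℚ) → List (Fin n) → ℚ
sumL x = foldr (λ v s → x v + s) 0ℚ

member : List (Fin n) → Fin n → Bool
member L v = foldr (λ u b → ⌊ v ≟ u ⌋ ∨ b) false L

member-∉ : ∀ {u : Fin n} L → All (u ≢_) L → member L u ≡ false
member-∉ []      []        = refl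
member-∉ {u = u} (v ∷ L) (u≢v ∷ u∉L) with u ≟ v
... | yes u≡v = contradiction u≡v u≢v
... | no  _   = member-∉ L u∉L

-- The list counts multiplicities and the indicator does not, so the entries have to be distinct;
-- then putting `u` in front changes the indicator at `u` alone.
xOf-member : ∀ {n} (x : Fin n → ℚ) {L} → AllPairs _≢_ L → xOf x (member L) ≡ sumL x L
xOf-member {n} x []  = Σ-zero n (λ i → ℚ.*-zeroˡ (x i))
xOf-member {n} x {u ∷ L} (u∉L ∷ uniq) = trans
  (Σ-update _ _ u (x u) at off) (cong (x u +_) (xOf-member x uniq))
  where
  at : χ (member (u ∷ L)) u * x u ≡ x u + χ (member L) u * x u
  at rewrite member-∉ L u∉L with u ≟ u
  ... | yes _ = trans (ℚ.*-identityˡ (x u))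
                  (≡.sym (trans (cong (x u +_) (ℚ.*-zeroˡ (x u))) (ℚ.+-identityʳ (x u))))
  ... | no u≢u = contradiction refl u≢u
  off : ∀ j → j ≢ u → χ (member (u ∷ L)) j * x j ≡ χ (member L) j * x j
  off j j≢u with j ≟ u
  ... | yes j≡u = contradiction j≡u j≢u
  ... | no _    = refl

Adjacent : Graph n → Fin n → Fin n → Set
Adjacent G i j = adj G i j ≡ true

Adjacent⇒≢ : (G : Graph n) → ∀ {i j} → Adjacent G i j → i ≢ j
Adjacent⇒≢ G {i} p refl with () ← trans (≡.sym p) (irrefl G i)

member-lookup : ∀ {P : Fin n → Set} {L v} → All P L → member L v ≡ true → P v
member-lookup {v = v} (_∷_ {u} p ps) m with v ≟ u
... | yes refl = p
... | no _     = member-lookup ps m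

member-clique : (G : Graph n) → ∀ {L} → AllPairs (Adjacent G) L → IsClique G (member L)
member-clique G (_∷_ {u} u-L c) i j i≢j p q with i ≟ u | j ≟ u
... | yes refl | yes refl = contradiction refl i≢j
... | yes refl | no _     = member-lookup u-L q
... | no _     | yes refl = trans (sym G i u) (member-lookup u-L p)
... | no _     | no _     = member-clique G c i j i≢j p q

-- Linear functionals and the inequalities valid for STAB.

record Linear (F : (Fin n → ℚ) → ℚ) : Set where
  field
    -- Pointwise equal vectors need not be equal as functions, hence a separate field. The form
    -- `a * x + y` of `F-linear` is the one in which `InSTAB` adds its stable sets one by one.
    F-cong   : ∀ {x y} → (∀ i → x i ≡ y i) → F x ≡ F y
    F-linear : ∀ a x y → F (λ i → a * x i + y i) ≡ a * F x + F y

  F-zero : F (λ _ → 0ℚ) ≡ 0ℚ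
  -- With `a = -1` and two zero vectors the combination evaluates to the zero vector, so
  -- `F 0 = - F 0 + F 0`.
  F-zero = trans (F-linear (- 1ℚ) (λ _ → 0ℚ) (λ _ → 0ℚ)) (trans
    (cong (_+ F (λ _ → 0ℚ)) (≡.sym (ℚ.neg-distribˡ-* 1ℚ (F (λ _ → 0ℚ)))))
    (trans (cong (λ c → - c + F (λ _ → 0ℚ)) (ℚ.*-identityˡ (F (λ _ → 0ℚ)))) (ℚ.+-inverseˡ (F (λ _ → 0ℚ)))))
open Linear

coordinate-linear : (v : Fin n) → Linear (λ x → x v)
coordinate-linear v = record { F-cong = λ eq → eq v ; F-linear = λ a x y → refl }

scale-linear : ∀ c {F : (Fin n → ℚ) → ℚ} → Linear F → Linear (λ x → c * F x)
scale-linear c {F} l = record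
  { F-cong   = λ eq → cong (c *_) (F-cong l eq)
  ; F-linear = λ a x y → trans (cong (c *_) (F-linear l a x y))
      (solve 4 (λ c a u v → c :* (a :* u :+ v) := a :* (c :* u) :+ c :* v) refl c a (F x) (F y)) }

+-linear : ∀ {F H : (Fin n → ℚ) → ℚ} → Linear F → Linear H → Linear (λ x → F x + H x)
+-linear {F = F} {H} l l' = record
  { F-cong   = λ eq → cong₂ _+_ (F-cong l eq) (F-cong l' eq)
  ; F-linear = λ a x y → trans (cong₂ _+_ (F-linear l a x y) (F-linear l' a x y))
      (solve 5 (λ a u v s t → (a :* u :+ v) :+ (a :* s :+ t) := a :* (u :+ s) :+ (v :+ t)) refl
        a (F x) (F y) (H x) (H y)) }

Σ-Linear : ∀ m {F : Fin m → (Fin n → ℚ) → ℚ} → (∀ i → Linear (F i)) → Linear (λ x → Σℚ m (λ i → F i x))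
Σ-Linear m {F} l = record
  { F-cong   = λ eq → Σ-cong m (λ i → F-cong (l i) eq)
  ; F-linear = λ a x y → trans (Σ-cong m (λ i → F-linear (l i) a x y))
      (Σ-linear m a (λ i → F i x) (λ i → F i y)) }

joinedLHS-linear : ∀ {G : Graph n} (J : JoinedAntiweb G) → Linear (joinedLHS J)
joinedLHS-linear J = +-linear
  (Σ-Linear t (λ i → scale-linear ((ℤ.+ 1) / suc (αp i)) (Σ-Linear (m i) (λ a → coordinate-linear _))))
  (Σ-Linear q (λ c → coordinate-linear _))
  where open JoinedAntiweb J

STAB-nonneg : ∀ {G : Graph n} {x} → InSTAB G x → ∀ i → 0ℚ ≤ x i
STAB-nonneg (L , w , _ , eq) i = subst (0ℚ ≤_) (≡.sym (eq i)) (go w)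
  where
  go : ∀ {L} → All _ L → 0ℚ ≤ foldr (λ p s → proj₁ p * χ (proj₂ p) i + s) 0ℚ L
  go [] = ℚ.≤-refl
  go (_∷_ {c , S} (c≥0 , _) w) with S i
  ... | true  = ℚ.+-mono-≤ (subst (0ℚ ≤_) (≡.sym (ℚ.*-identityʳ c)) c≥0) (go w)
  ... | false = ℚ.+-mono-≤ (ℚ.≤-reflexive (≡.sym (ℚ.*-zeroʳ c))) (go w)

-- The value at a convex combination is the weighted mean of the values at its stable sets, and the
-- weights add up to the right-hand side 1.
STAB-valid : ∀ {G : Graph n} {F} → Linear F → (∀ S → Stable (adj G) S → F (χ S) ≤ 1ℚ) →
  ∀ {x} → InSTAB G x → F x ≤ 1ℚ
STAB-valid {n} {G} {F} l valid (L , w , Σ≡1 , eq) =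
  subst₂ _≤_ (≡.sym (F-cong l eq)) Σ≡1 (go w)
  where
  comb : List (ℚ × (Fin n → Bool)) → Fin n → ℚ
  comb L i = foldr (λ p s → proj₁ p * χ (proj₂ p) i + s) 0ℚ L
  go : ∀ {L} → All (λ p → (0ℚ ≤ proj₁ p) × Stable (adj G) (proj₂ p)) L →
       F (comb L) ≤ foldr (λ p s → proj₁ p + s) 0ℚ L
  go [] = ℚ.≤-reflexive (F-zero l)
  go {(c , S) ∷ L} ((c≥0 , st) ∷ w) = ℚ.≤-trans
    (ℚ.≤-reflexive (F-linear l c (χ S) (comb L)))
    (ℚ.+-mono-≤ (subst (c * F (χ S) ≤_) (ℚ.*-identityʳ c) (*-monoʳ c≥0 (valid S st))) (go w))

stable-adjacent : ∀ {G : Graph n} {S} → Stable (adj G) S → ∀ {u v} →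
  S u ≡ true → S v ≡ true → ¬ Adjacent G u v
stable-adjacent {G = G} st {u} {v} p q uv
  with () ← trans (≡.sym uv) (st u v (Adjacent⇒≢ G uv) p q)

-- An antiweb met by `S` contributes at most α/α = 1, since `S` restricts to a stable set of it.
-- Nodes of different parts are adjacent, which excludes a second hit: first among the antiwebs,
-- then among the nodes of the clique, and last, in `conclude`, between the two kinds.
joined-valid : ∀ {G : Graph n} (J : JoinedAntiweb G) S → Stable (adj G) S → joinedLHS J (χ S) ≤ 1ℚ
joined-valid {G = G} J S st = conclude
  (Σ-exclusive t term (λ i → ∃ λ a → S (emb (inj₁ (i , a))) ≡ true) hitA exclA)
  (Σ-exclusive q (λ c → χ S (emb (inj₂ c))) (λ c → S (emb (inj₂ c)) ≡ true) hitQ exclQ)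
  where
  open JoinedAntiweb J
  ⊥-adj : ∀ {u v} → S u ≡ true → S v ≡ true → ¬ Adjacent G u v
  ⊥-adj = stable-adjacent {G = G} st
  part : ∀ i → Fin (m i) → Bool
  part i a = S (emb (inj₁ (i , a)))
  term : Fin t → ℚ
  term i = ((ℤ.+ 1) / suc (αp i)) * Σℚ (m i) (χ (part i))
  part-stable : ∀ i → Stable (antiwebAdj (m i) (k i)) (part i)
  part-stable i a b a≢b p p′ = trans (≡.sym (emb-antiweb i a b a≢b))
    (st _ _ (λ e → a≢b (pair-injective (emb-inj e))) p p′)
    where
    pair-injective : ∀ {a b} → inj₁ {B = Fin q} (i , a) ≡ inj₁ (i , b) → a ≡ b
    pair-injective refl = refl
  hitA : ∀ i → term i ≡ 0ℚ ⊎ (term i ≤ 1ℚ × ∃ λ a → part i a ≡ true)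
  hitA i with size≡0⊎∃ (part i)
  ... | inj₁ none = inj₁ (trans (cong (((ℤ.+ 1) / suc (αp i)) *_)
                      (Σ-zero (m i) (λ a → cong (λ b → if b then 1ℚ else 0ℚ) (none a))))
                      (ℚ.*-zeroʳ ((ℤ.+ 1) / suc (αp i))))
  ... | inj₂ hit  = inj₂ (recip-≤1 (αp i) (subst (_≤ ℕ→ℚ (suc (αp i))) (≡.sym (Σ-χ (m i) (part i)))
                      (ℕ→ℚ-mono (proj₂ (isα i) (part i) (part-stable i)))) , hit)
  exclA : ∀ i j → ∃ (λ a → part i a ≡ true) → ∃ (λ b → part j b ≡ true) → i ≡ j
  exclA i j (a , p) (b , q) with i ≟ j
  ... | yes i≡j = i≡j
  ... | no  i≢j = ⊥-elim (⊥-adj p q (emb-across i j a b i≢j))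
  hitQ : ∀ c → χ S (emb (inj₂ c)) ≡ 0ℚ ⊎ (χ S (emb (inj₂ c)) ≤ 1ℚ × S (emb (inj₂ c)) ≡ true)
  hitQ c with S (emb (inj₂ c))
  ... | true  = inj₂ (ℚ.≤-refl , refl)
  ... | false = inj₁ refl
  exclQ : ∀ c d → S (emb (inj₂ c)) ≡ true → S (emb (inj₂ d)) ≡ true → c ≡ d
  exclQ c d p q with c ≟ d
  ... | yes c≡d = c≡d
  ... | no  c≢d = ⊥-elim (⊥-adj p q (emb-Q c d c≢d))
  conclude : ∀ {x y} → x ≡ 0ℚ ⊎ (x ≤ 1ℚ × ∃ λ i → ∃ λ a → S (emb (inj₁ (i , a))) ≡ true) →
    y ≡ 0ℚ ⊎ (y ≤ 1ℚ × ∃ λ c → S (emb (inj₂ c)) ≡ true) → x + y ≤ 1ℚ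
  conclude (inj₁ refl) (inj₁ refl) = 0≤1
  conclude {x} (inj₂ (l , _)) (inj₁ refl) = subst (_≤ 1ℚ) (≡.sym (ℚ.+-identityʳ x)) l
  conclude {y = y} (inj₁ refl) (inj₂ (l , _)) = subst (_≤ 1ℚ) (≡.sym (ℚ.+-identityˡ y)) l
  conclude (inj₂ (_ , i , a , p)) (inj₂ (_ , c , q)) = ⊥-elim (⊥-adj p q (emb-AQ i a c))

STAB⊆ASTAB* : ∀ {G : Graph n} {x} → InSTAB G x → InASTAB* G x
STAB⊆ASTAB* {G = G} s = STAB-nonneg {G = G} s , λ J → STAB-valid {G = G} (joinedLHS-linear J) (joined-valid J) s

-- Adjacency in antiwebs as bounds on the distance of indices.

T→≡ : ∀ {b} → T b → b ≡ true
T→≡ = Equivalence.to T-≡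

≡→T : ∀ {b} → b ≡ true → T b
≡→T = Equivalence.from T-≡

∧-true : ∀ {a b} → a ∧ b ≡ true → a ≡ true × b ≡ true
∧-true {true} {true} _ = refl , refl

∨-true : ∀ {a b} → a ∨ b ≡ true → a ≡ true ⊎ b ≡ true
∨-true {true}         _ = inj₁ refl
∨-true {false} {true} _ = inj₂ refl

antiweb-true : ∀ {m k} {a b : Fin m} → a ≢ b →
  k ℕ.≤ ∣ toℕ a - toℕ b ∣ → ∣ toℕ a - toℕ b ∣ ℕ.≤ m ∸ k → antiwebAdj m k a b ≡ true
antiweb-true {m} {k} {a} {b} a≢b lo hi with a ≟ b
... | yes a≡b = contradiction a≡b a≢b
... | no _    = cong₂ _∧_ (T→≡ (ℕ.≤⇒≤ᵇ lo)) (T→≡ (ℕ.≤⇒≤ᵇ hi))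

antiweb-true⁻¹ : ∀ {m k} {a b : Fin m} → antiwebAdj m k a b ≡ true →
  k ℕ.≤ ∣ toℕ a - toℕ b ∣ × ∣ toℕ a - toℕ b ∣ ℕ.≤ m ∸ k
antiweb-true⁻¹ {m} {k} {a} {b} eq with a ≟ b
antiweb-true⁻¹ () | yes _
... | no _ with ∧-true {a = k ≤ᵇ ∣ toℕ a - toℕ b ∣} eq
... | lo , hi = ℕ.≤ᵇ⇒≤ k _ (≡→T lo) , ℕ.≤ᵇ⇒≤ _ (m ∸ k) (≡→T hi)

antiweb-false : ∀ {m k} {a b : Fin m} → ∣ toℕ a - toℕ b ∣ ℕ.< k → antiwebAdj m k a b ≡ false
antiweb-false {k = k} {a} {b} lt = ¬-not λ eq → ℕ.<⇒≱ lt (proj₁ (antiweb-true⁻¹ {k = k} {a} {b} eq))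

∣-∣-≡ : ∀ {a b d} → b ≡ a ℕ.+ d → ∣ a - b ∣ ≡ d
∣-∣-≡ {a} {d = d} refl = ℕ.∣m-m+n∣≡n a d

∣-∣-≡⁻¹ : ∀ {a b d} → ∣ a - b ∣ ≡ d → b ≡ a ℕ.+ d ⊎ a ≡ b ℕ.+ d
∣-∣-≡⁻¹ {a} {b} refl with ℕ.≤-total a b
... | inj₁ a≤b = inj₁ (≡.sym (trans (cong (a ℕ.+_) (ℕ.m≤n⇒∣m-n∣≡n∸m a≤b)) (ℕ.m+[n∸m]≡n a≤b)))
... | inj₂ b≤a = inj₂ (≡.sym (trans (cong (b ℕ.+_) (ℕ.m≤n⇒∣n-m∣≡n∸m b≤a)) (ℕ.m+[n∸m]≡n b≤a)))

∣-∣-< : ∀ {a b r} → a ℕ.< r → b ℕ.< r → ∣ a - b ∣ ℕ.< r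
∣-∣-< {a} {b} a<r b<r = ℕ.≤-<-trans (ℕ.∣m-n∣≤m⊔n a b) (ℕ.⊔-lub a<r b<r)

initial : ∀ {m} → ℕ → Fin m → Bool
initial r a = toℕ a <ᵇ r

size-initial : ∀ {m r} → r ℕ.≤ m → size (initial {m} r) ≡ r
size-initial {zero}          z≤n      = refl
size-initial {suc m} {zero}  z≤n      = size-initial {m} z≤n
size-initial {suc m} {suc r} (s≤s le) = cong suc (size-initial le)

-- Indices below `k` differ by less than `k`. Such sets are the large stable sets of the complete
-- graph, the matching, the prism and the odd hole below.
initial-stable : ∀ {m} k {r} → r ℕ.≤ k → Stable (antiwebAdj m k) (initial r)
initial-stable k {r} r≤k a b _ p q = antiweb-false {k = k} {a} {b}
  (ℕ.<-≤-trans (∣-∣-< (ℕ.<ᵇ⇒< (toℕ a) r (≡→T p)) (ℕ.<ᵇ⇒< (toℕ b) r (≡→T q))) r≤k)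

-- The antiweb A^k_{2k+1} as a cycle.

Far : ℕ → ℕ → ℕ → Set
Far k a b = b ≡ a ℕ.+ k ⊎ b ≡ a ℕ.+ suc k

2k+1∸k : ∀ k → suc (2 ℕ.* k) ∸ k ≡ suc k
2k+1∸k k = trans (ℕ.+-∸-assoc 1 (ℕ.m≤m+n k (k ℕ.+ 0)))
  (cong suc (trans (ℕ.m+n∸m≡n k (k ℕ.+ 0)) (ℕ.+-identityʳ k)))

Far⇒dist : ∀ {k a b} → Far k a b → k ℕ.≤ ∣ a - b ∣ × ∣ a - b ∣ ℕ.≤ suc k
Far⇒dist {k} {a} (inj₁ e) rewrite ∣-∣-≡ {a} e = ℕ.≤-refl , ℕ.n≤1+n k
Far⇒dist {k} {a} (inj₂ e) rewrite ∣-∣-≡ {a} e = ℕ.n≤1+n k , ℕ.≤-refl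

-- For `m = 2k + 1` the upper bound `m ∸ k` is `k + 1`, so `k` and `k + 1` are the only distances of
-- adjacent nodes; `Far` lists them with the larger index written as a sum.
Far⇒antiweb : ∀ {k} {a b : Fin (suc (2 ℕ.* k))} → a ≢ b →
  Far k (toℕ a) (toℕ b) ⊎ Far k (toℕ b) (toℕ a) → antiwebAdj (suc (2 ℕ.* k)) k a b ≡ true
Far⇒antiweb {k} {a} {b} a≢b far = antiweb-true {k = k} {a} {b} a≢b (proj₁ bounds)
  (subst (∣ toℕ a - toℕ b ∣ ℕ.≤_) (≡.sym (2k+1∸k k)) (proj₂ bounds))
  where
  bounds : k ℕ.≤ ∣ toℕ a - toℕ b ∣ × ∣ toℕ a - toℕ b ∣ ℕ.≤ suc k
  bounds = [ Far⇒dist , subst (λ d → k ℕ.≤ d × d ℕ.≤ suc k) (ℕ.∣-∣-comm (toℕ b) (toℕ a)) ∘ Far⇒dist ]′ far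

antiweb⇒Far : ∀ {k} {a b : Fin (suc (2 ℕ.* k))} → antiwebAdj (suc (2 ℕ.* k)) k a b ≡ true →
  Far k (toℕ a) (toℕ b) ⊎ Far k (toℕ b) (toℕ a)
antiweb⇒Far {k} {a} {b} eq with antiweb-true⁻¹ {k = k} {a} {b} eq
... | lo , hi with ∣ toℕ a - toℕ b ∣ ℕ.≟ k
... | yes d≡k = Sum.map inj₁ inj₁ (∣-∣-≡⁻¹ d≡k)
... | no  d≢k = Sum.map inj₂ inj₂ (∣-∣-≡⁻¹
                  (ℕ.≤-antisym (subst (∣ toℕ a - toℕ b ∣ ℕ.≤_) (2k+1∸k k) hi) (ℕ.≤∧≢⇒< lo (d≢k ∘ ≡.sym))))

-- The cyclic successor with the wrap-around as a case of its own in place of `%`.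
Step : ℕ → ℕ → ℕ → Set
Step L a b = b ≡ suc a ⊎ (suc a ≡ L × b ≡ 0)

suc-% : ∀ L → .{{_ : ℕ.NonZero L}} → ∀ {a} → a ℕ.< L →
  (suc a ℕ.< L × suc a % L ≡ suc a) ⊎ (suc a ≡ L × suc a % L ≡ 0)
suc-% L {a} a<L with ℕ.m≤n⇒m<n∨m≡n a<L
... | inj₁ lt   = inj₁ (lt , m<n⇒m%n≡m lt)
... | inj₂ refl = inj₂ (refl , n%n≡0 L)

≡%⇒Step : ∀ L → .{{_ : ℕ.NonZero L}} → ∀ {a b} → a ℕ.< L → b ≡ suc a % L → Step L a b
≡%⇒Step L a<L e with suc-% L a<L
... | inj₁ (_ , e′)  = inj₁ (trans e e′)
... | inj₂ (w , e′)  = inj₂ (w , trans e e′)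

Step⇒≡% : ∀ L → .{{_ : ℕ.NonZero L}} → ∀ {a b} → a ℕ.< L → b ℕ.< L → Step L a b → b ≡ suc a % L
Step⇒≡% L a<L b<L s with suc-% L a<L | s
... | inj₁ (_ , e)    | inj₁ b≡        = trans b≡ (≡.sym e)
... | inj₁ (lt , e)   | inj₂ (w , _)   = contradiction w (ℕ.<⇒≢ lt)
... | inj₂ (w , e)    | inj₁ refl      = contradiction w (ℕ.<⇒≢ b<L)
... | inj₂ (w , e)    | inj₂ (_ , b≡0) = trans b≡0 (≡.sym e)

cycle⇒Step : ∀ L → .{{_ : ℕ.NonZero L}} → ∀ {a b : Fin L} → cycleAdj L a b ≡ true →
  Step L (toℕ a) (toℕ b) ⊎ Step L (toℕ b) (toℕ a)
cycle⇒Step L {a} {b} eq = Sum.map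
  (λ e → ≡%⇒Step L (toℕ<n a) (ℕ.≡ᵇ⇒≡ (toℕ b) _ (≡→T e)))
  (λ e → ≡%⇒Step L (toℕ<n b) (ℕ.≡ᵇ⇒≡ (toℕ a) _ (≡→T e)))
  (∨-true eq)

Step⇒cycle : ∀ L → .{{_ : ℕ.NonZero L}} → ∀ {a b : Fin L} →
  Step L (toℕ a) (toℕ b) ⊎ Step L (toℕ b) (toℕ a) → cycleAdj L a b ≡ true
Step⇒cycle L {a} {b} (inj₁ s) = cong (_∨ (toℕ a ≡ᵇ (suc (toℕ b) % L)))
  (T→≡ (ℕ.≡⇒≡ᵇ (toℕ b) _ (Step⇒≡% L (toℕ<n a) (toℕ<n b) s)))
Step⇒cycle L {a} {b} (inj₂ s) = trans (cong ((toℕ b ≡ᵇ (suc (toℕ a) % L)) ∨_)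
  (T→≡ (ℕ.≡⇒≡ᵇ (toℕ a) _ (Step⇒≡% L (toℕ<n b) (toℕ<n a) s)))) (∨-zeroʳ _)

-- Walking along the odd hole A^k_{2k+1} visits 0, k+1, 1, k+2, 2, …, 2k, k.
data Visit (k : ℕ) : ℕ → ℕ → Set where
  low  : ∀ {i} → i ℕ.≤ k → Visit k i (2 ℕ.* i)
  high : ∀ {i} → i ℕ.< k → Visit k (suc k ℕ.+ i) (suc (2 ℕ.* i))

double-injective : ∀ {i j} → 2 ℕ.* i ≡ 2 ℕ.* j → i ≡ j
double-injective {i} {j} = ℕ.*-cancelˡ-≡ i j 2

-- Labels up to `k` sit at even positions and larger labels at odd ones. This settles the mixed
-- cases here and in `visit-label`; within one kind the position is an injective function of the
-- label.
visit-position : ∀ {k l l′ p p′} → Visit k l p → Visit k l′ p′ → l ≡ l′ → p ≡ p′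
visit-position (low _)  (low _)  e = cong (2 ℕ.*_) e
visit-position {k} (low le) (high {j} _) refl = contradiction le (ℕ.<⇒≱ (ℕ.m≤m+n (suc k) j))
visit-position {k} (high {i} _) (low le) refl = contradiction le (ℕ.<⇒≱ (ℕ.m≤m+n (suc k) i))
visit-position {k} (high {i} _) (high {j} _) e = cong (λ i → suc (2 ℕ.* i)) (ℕ.+-cancelˡ-≡ (suc k) i j e)

visit-label : ∀ {k l l′ p p′} → Visit k l p → Visit k l′ p′ → p ≡ p′ → l ≡ l′
visit-label (low _)  (low _)  e = double-injective e
visit-label (low {i} _)  (high {j} _) e = contradiction e (ℕ.even≢odd i j)
visit-label (high {i} _) (low {j} _)  e = contradiction (≡.sym e) (ℕ.even≢odd j i)
visit-label {k} (high _) (high _) e = cong (suc k ℕ.+_) (double-injective (ℕ.suc-injective e))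

-- Label `i` at position `2i` is followed by label `k+1+i`, at distance `k+1`, and for `i ≥ 1`
-- preceded by `k+i`, at distance `k`. The one remaining pair is `0` and `k`, which closes the cycle
-- from position `2k` to position `0`.
Far⇒Step : ∀ {k l l′ p p′} → Visit k l p → Visit k l′ p′ → Far k l l′ →
  Step (suc (2 ℕ.* k)) p p′ ⊎ Step (suc (2 ℕ.* k)) p′ p
Far⇒Step {k} (low {i} _) (low j≤k) (inj₁ refl)
  with refl ← ℕ.n≤0⇒n≡0 (ℕ.+-cancelʳ-≤ k i 0 j≤k) = inj₂ (inj₂ (refl , refl))
Far⇒Step {k} (low {i} _) (low j≤k) (inj₂ refl) = contradiction j≤k (ℕ.<⇒≱ (ℕ.m≤n+m (suc k) i))
Far⇒Step {k} (low {i} _) (high {j} _) (inj₁ e)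
  with refl ← ℕ.+-cancelˡ-≡ k (suc j) i (trans (ℕ.+-suc k j) (trans e (ℕ.+-comm i k))) =
  inj₂ (inj₁ (ℕ.*-suc 2 j))
Far⇒Step {k} (low {i} _) (high {j} _) (inj₂ e)
  with refl ← ℕ.+-cancelˡ-≡ (suc k) j i (trans e (ℕ.+-comm i (suc k))) = inj₁ (inj₁ refl)
Far⇒Step {k} (high {i} _) (low j≤k) (inj₁ refl) =
  contradiction j≤k (ℕ.<⇒≱ (ℕ.≤-trans (ℕ.m≤m+n (suc k) i) (ℕ.m≤m+n (suc k ℕ.+ i) k)))
Far⇒Step {k} (high {i} _) (low j≤k) (inj₂ refl) =
  contradiction j≤k (ℕ.<⇒≱ (ℕ.≤-trans (ℕ.m≤m+n (suc k) i) (ℕ.m≤m+n (suc k ℕ.+ i) (suc k))))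
Far⇒Step {k} (high {i} _) (high {j} j<k) (inj₁ e)
  with refl ← ℕ.+-cancelˡ-≡ (suc k) j (i ℕ.+ k) (trans e (ℕ.+-assoc (suc k) i k)) =
  contradiction j<k (ℕ.≤⇒≯ (ℕ.m≤n+m k i))
Far⇒Step {k} (high {i} _) (high {j} j<k) (inj₂ e)
  with refl ← ℕ.+-cancelˡ-≡ (suc k) j (i ℕ.+ suc k) (trans e (ℕ.+-assoc (suc k) i (suc k))) =
  contradiction j<k (ℕ.≤⇒≯ (ℕ.≤-trans (ℕ.n≤1+n k) (ℕ.m≤n+m (suc k) i)))

Step⇒Far : ∀ {k l l′ p p′} → Visit k l p → Visit k l′ p′ → Step (suc (2 ℕ.* k)) p p′ →
  Far k l l′ ⊎ Far k l′ l
Step⇒Far (low {i} _) (low {j} _) (inj₁ e) = contradiction e (ℕ.even≢odd j i)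
Step⇒Far {k} (low {i} _) (low {j} _) (inj₂ (e , e₀))
  with refl ← double-injective {i} {k} (ℕ.suc-injective e) | refl ← double-injective {j} {0} e₀ =
  inj₂ (inj₁ refl)
Step⇒Far {k} (low {i} _) (high {j} _) (inj₁ e)
  with refl ← double-injective {j} {i} (ℕ.suc-injective e) = inj₁ (inj₂ (ℕ.+-comm (suc k) j))
Step⇒Far (low _) (high _) (inj₂ (_ , ()))
Step⇒Far {k} (high {j} _) (low {i} _) (inj₁ e)
  with refl ← double-injective {i} {suc j} (trans e (≡.sym (ℕ.*-suc 2 j))) =
  inj₂ (inj₁ (cong suc (ℕ.+-comm k j)))
Step⇒Far {k} (high {j} _) (low _) (inj₂ (e , _)) =
  contradiction (≡.sym (ℕ.suc-injective e)) (ℕ.even≢odd k j)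
Step⇒Far (high {i} _) (high {j} _) (inj₁ e) =
  contradiction (ℕ.suc-injective e) (ℕ.even≢odd j i)
Step⇒Far (high _) (high _) (inj₂ (_ , ()))

label-view : ∀ k l → l ℕ.< suc (2 ℕ.* k) → ∃ λ p → p ℕ.< suc (2 ℕ.* k) × Visit k l p
label-view k l l<L with l ℕ.≤? k
... | yes l≤k = 2 ℕ.* l , s≤s (ℕ.*-monoʳ-≤ 2 l≤k) , low l≤k
... | no  l≰k = _ , s≤s (ℕ.<-≤-trans (ℕ.*-monoʳ-< 2 i<k) ℕ.≤-refl) ,
                subst (λ l → Visit k l (suc (2 ℕ.* i))) l≡ (high i<k)
  where
  i = l ∸ suc k
  l≡ : suc k ℕ.+ i ≡ l
  l≡ = ℕ.m+[n∸m]≡n (ℕ.≰⇒> l≰k)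
  i<k : i ℕ.< k
  i<k = ℕ.+-cancelˡ-< (suc k) i k (subst₂ ℕ._<_ (≡.sym l≡) (cong (λ n → suc (k ℕ.+ n)) (ℕ.+-identityʳ k)) l<L)

parity : ∀ p → ∃ λ i → p ≡ 2 ℕ.* i ⊎ p ≡ suc (2 ℕ.* i)
parity zero = 0 , inj₁ refl
parity (suc p) with parity p
... | i , inj₁ refl = i , inj₂ refl
... | i , inj₂ refl = suc i , inj₁ (≡.sym (ℕ.*-suc 2 i))

position-view : ∀ k p → p ℕ.< suc (2 ℕ.* k) → ∃ λ l → l ℕ.< suc (2 ℕ.* k) × Visit k l p
position-view k p (s≤s p≤2k) with parity p
... | i , inj₁ refl = i , s≤s (ℕ.≤-trans i≤k (ℕ.m≤m+n k _)) , low i≤k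
  where i≤k = ℕ.*-cancelˡ-≤ 2 p≤2k
... | i , inj₂ refl = suc k ℕ.+ i ,
    s≤s (ℕ.+-monoʳ-< k (subst (i ℕ.<_) (≡.sym (ℕ.+-identityʳ k)) i<k)) , high i<k
  where i<k = ℕ.*-cancelˡ-< 2 i k p≤2k

module _ (k : ℕ) where

  private
    L : ℕ
    L = suc (2 ℕ.* k)

  position : Fin L → Fin L
  position a = fromℕ< (proj₁ (proj₂ (label-view k (toℕ a) (toℕ<n a))))

  label : Fin L → Fin L
  label p = fromℕ< (proj₁ (proj₂ (position-view k (toℕ p) (toℕ<n p))))

  visits : ∀ a → Visit k (toℕ a) (toℕ (position a))
  visits a with label-view k (toℕ a) (toℕ<n a)
  ... | p , p<L , v = subst (Visit k (toℕ a)) (≡.sym (toℕ-fromℕ< p<L)) v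

  visited : ∀ p → Visit k (toℕ (label p)) (toℕ p)
  visited p with position-view k (toℕ p) (toℕ<n p)
  ... | l , l<L , v = subst (λ l → Visit k l (toℕ p)) (≡.sym (toℕ-fromℕ< l<L)) v

  position-label : ∀ p → position (label p) ≡ p
  position-label p = toℕ-injective (visit-position (visits (label p)) (visited p) refl)

  label-position : ∀ a → label (position a) ≡ a
  label-position a = toℕ-injective (visit-label (visited (position a)) (visits a) refl)

  visit-permutation : Permutation L L
  visit-permutation = permutation position label position-label label-position

  cycle≡antiweb : ∀ {a b} → a ≢ b → cycleAdj L (position a) (position b) ≡ antiwebAdj L k a b
  cycle≡antiweb {a} {b} a≢b = ⇔→≡ {z = true} (mk⇔
    (λ c → Far⇒antiweb a≢b
      ([ Step⇒Far (visits a) (visits b) , Sum.swap ∘ Step⇒Far (visits b) (visits a) ]′ (cycle⇒Step L c)))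
    (λ w → Step⇒cycle L
      ([ Far⇒Step (visits a) (visits b) , Sum.swap ∘ Far⇒Step (visits b) (visits a) ]′ (antiweb⇒Far {k} {a} {b} w))))

  -- Every pair `{o + j, k + 1 + j}` is an edge by `far`, so `S` contains at most one of its nodes,
  -- and the index `j` of the pair is injective on `S`.
  α-bound : ∀ (S : Fin L → Bool) o → (∀ j → Far k (o ℕ.+ j) (suc k ℕ.+ j)) →
    (∀ a → S a ≡ true → Σ (Fin k) λ j → toℕ a ≡ o ℕ.+ toℕ j ⊎ toℕ a ≡ suc k ℕ.+ toℕ j) →
    Stable (antiwebAdj L k) S → size S ℕ.≤ k
  α-bound S o far pair st = size-≤ S (λ a p → proj₁ (pair a p)) λ {a} {b} p q eq →
    same p q (proj₂ (pair a p)) (subst (λ j → toℕ b ≡ o ℕ.+ toℕ j ⊎ toℕ b ≡ suc k ℕ.+ toℕ j)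
      (≡.sym eq) (proj₂ (pair b q)))
    where
    nonadjacent : ∀ {a b} → S a ≡ true → S b ≡ true → ∀ {j} →
      toℕ a ≡ o ℕ.+ j → toℕ b ≡ suc k ℕ.+ j → a ≡ b
    nonadjacent {a} {b} p q {j} ea eb with a ≟ b
    ... | yes a≡b = a≡b
    ... | no  a≢b with () ← trans (≡.sym (st a b a≢b p q))
                         (Far⇒antiweb a≢b (inj₁ (subst₂ (Far k) (≡.sym ea) (≡.sym eb) (far j))))
    same : ∀ {a b} → S a ≡ true → S b ≡ true → ∀ {j : Fin k} →
      toℕ a ≡ o ℕ.+ toℕ j ⊎ toℕ a ≡ suc k ℕ.+ toℕ j →
      toℕ b ≡ o ℕ.+ toℕ j ⊎ toℕ b ≡ suc k ℕ.+ toℕ j → a ≡ b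
    same p q (inj₁ e) (inj₁ e′) = toℕ-injective (trans e (≡.sym e′))
    same p q (inj₂ e) (inj₂ e′) = toℕ-injective (trans e (≡.sym e′))
    same p q (inj₁ e) (inj₂ e′) = nonadjacent p q e e′
    same p q (inj₂ e) (inj₁ e′) = ≡.sym (nonadjacent q p e′ e)

  -- A stable set containing 0 avoids k, and the other nodes split into the edges {j, k+1+j};
  -- without 0 they split into the edges {1+j, k+1+j}.
  α-odd : 1 ℕ.≤ k → IsAlpha (antiwebAdj L k) k
  α-odd k≥1 = (initial k , initial-stable k ℕ.≤-refl , size-initial (ℕ.≤-trans (ℕ.m≤m+n k _) (ℕ.n≤1+n _))) , bound
    where
    to-pair : ∀ {a : Fin L} → k ℕ.< toℕ a → Σ (Fin k) λ j → toℕ a ≡ suc k ℕ.+ toℕ j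
    to-pair {a} k<a with label-view k (toℕ a) (toℕ<n a)
    ... | _ , _ , v = go v k<a
      where
      go : ∀ {l p} → Visit k l p → k ℕ.< l → Σ (Fin k) λ j → l ≡ suc k ℕ.+ toℕ j
      go (low l≤k)  k<l = contradiction l≤k (ℕ.<⇒≱ k<l)
      go (high i<k) _   = fromℕ< i<k , cong (suc k ℕ.+_) (≡.sym (toℕ-fromℕ< i<k))
    bound : ∀ S → Stable (antiwebAdj L k) S → size S ℕ.≤ k
    bound S st with S zero Bool.≟ true
    ... | yes S0 = α-bound S 0 (λ j → inj₂ (ℕ.+-comm (suc k) j)) pair st
      where
      pair : ∀ a → S a ≡ true → Σ (Fin k) λ j → toℕ a ≡ toℕ j ⊎ toℕ a ≡ suc k ℕ.+ toℕ j
      pair a p with ℕ.<-cmp (toℕ a) k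
      ... | tri< a<k _ _ = fromℕ< a<k , inj₁ (≡.sym (toℕ-fromℕ< a<k))
      ... | tri> _ _ k<a = proj₁ (to-pair k<a) , inj₂ (proj₂ (to-pair k<a))
      ... | tri≈ _ a≡k _ = contradiction (trans (≡.sym (st zero a 0≢a S0 p)) (Far⇒antiweb 0≢a (inj₁ (inj₁ a≡k)))) λ ()
        where
        0≢a : zero ≢ a
        0≢a refl = ℕ.<⇒≢ k≥1 a≡k
    ... | no ¬S0 = α-bound S 1 (λ j → inj₁ (cong suc (ℕ.+-comm k j))) pair st
      where
      pair : ∀ a → S a ≡ true → Σ (Fin k) λ j → toℕ a ≡ suc (toℕ j) ⊎ toℕ a ≡ suc k ℕ.+ toℕ j
      pair zero    p = contradiction p ¬S0
      pair (suc a) p with suc (toℕ a) ℕ.≤? k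
      ... | yes a<k = fromℕ< a<k , inj₁ (cong suc (≡.sym (toℕ-fromℕ< a<k)))
      ... | no  a≮k = proj₁ (to-pair (ℕ.≰⇒> a≮k)) , inj₂ (proj₂ (to-pair {suc a} (ℕ.≰⇒> a≮k)))

-- Classification of antiwebs.

record CliquePartition (m k : ℕ) : Set where
  field
    r          : ℕ
    colour     : Fin m → Fin r
    colour-adj : ∀ {a b} → a ≢ b → colour a ≡ colour b → antiwebAdj m k a b ≡ true
    -- A stable set with as many nodes as there are classes certifies that `r` is at most the
    -- stability number, without computing the latter.
    stable     : Fin m → Bool
    is-stable  : Stable (antiwebAdj m k) stable
    size≡r     : size stable ≡ r

-- The last two constructors record just the range of parameters in which the claw or the complement
-- of P₆ occurs; the nodes are exhibited in `no-antiweb-claw` and `no-antiweb-co-P₆`.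
data AntiwebCase (m k : ℕ) : Set where
  partitioned : CliquePartition m k → AntiwebCase m k
  odd-hole    : 2 ℕ.≤ k → m ≡ suc (2 ℕ.* k) → AntiwebCase m k
  claw        : 3 ℕ.≤ k → 2 ℕ.+ 2 ℕ.* k ℕ.≤ m → AntiwebCase m k
  co-P₆       : k ≡ 2 → 7 ℕ.≤ m → AntiwebCase m k

-- Distinct nodes have distance between 1 and `m - 1`, so A^1_m is complete and one class suffices.
complete-partition : ∀ {m} → 1 ℕ.≤ m → CliquePartition m 1
complete-partition {m@(suc m′)} m≥1 = record
  { r = 1 ; colour = λ _ → zero
  ; colour-adj = λ {a} {b} a≢b _ → antiweb-true {k = 1} {a} {b} a≢b
      (ℕ.n≢0⇒n>0 (a≢b ∘ toℕ-injective ∘ ℕ.∣m-n∣≡0⇒m≡n))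
      (ℕ.<⇒≤pred (∣-∣-< (toℕ<n a) (toℕ<n b)))
  ; stable = initial 1 ; is-stable = initial-stable 1 ℕ.≤-refl ; size≡r = size-initial m≥1 }

-- An edge would force `k ≤ m - k`. Hence there is none, and the classes are single nodes.
edgeless-partition : ∀ {m k} → m ℕ.< 2 ℕ.* k → CliquePartition m k
edgeless-partition {m} {k} m<2k = record
  { r = m ; colour = id ; colour-adj = λ a≢b a≡b → contradiction a≡b a≢b
  ; stable = initial m
  ; is-stable = λ a b _ _ _ → ¬-not λ e → ℕ.<⇒≱ m∸k<k
      (ℕ.≤-trans (proj₁ (antiweb-true⁻¹ {k = k} {a} {b} e)) (proj₂ (antiweb-true⁻¹ {k = k} {a} {b} e)))
  ; size≡r = size-initial ℕ.≤-refl }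
  where
  m∸k<k : m ∸ k ℕ.< k
  m∸k<k = ℕ.m<n+o⇒m∸n<o m k {{ℕ.>-nonZero k>0}} (subst (λ n → m ℕ.< k ℕ.+ n) (ℕ.+-identityʳ k) m<2k)
    where
    k>0 : 0 ℕ.< k
    k>0 = ℕ.n≢0⇒n>0 λ { refl → ℕ.n≮0 m<2k }

-- The only distance left is `k`, so the antiweb is the perfect matching of the pairs `{j, j + k}`.
matching-partition : ∀ k → CliquePartition (2 ℕ.* k) k
matching-partition k = record
  { r = k ; colour = λ a → proj₁ (pair a)
  ; colour-adj = λ {a} {b} a≢b eq → adjacent a≢b (proj₂ (pair a))
      (subst (λ j → toℕ b ≡ toℕ j ⊎ toℕ b ≡ toℕ j ℕ.+ k) (≡.sym eq) (proj₂ (pair b)))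
  ; stable = initial k ; is-stable = initial-stable k ℕ.≤-refl ; size≡r = size-initial (ℕ.m≤m+n k _) }
  where
  pair : (a : Fin (2 ℕ.* k)) → Σ (Fin k) λ j → toℕ a ≡ toℕ j ⊎ toℕ a ≡ toℕ j ℕ.+ k
  pair a with toℕ a ℕ.<? k
  ... | yes a<k = fromℕ< a<k , inj₁ (≡.sym (toℕ-fromℕ< a<k))
  ... | no  a≮k = fromℕ< lt , inj₂ (trans (≡.sym (ℕ.m∸n+n≡m (ℕ.≮⇒≥ a≮k))) (cong (ℕ._+ k) (≡.sym (toℕ-fromℕ< lt))))
    where
    lt : toℕ a ∸ k ℕ.< k
    lt = ℕ.+-cancelˡ-< k (toℕ a ∸ k) k
      (subst₂ ℕ._<_ (≡.sym (ℕ.m+[n∸m]≡n (ℕ.≮⇒≥ a≮k))) (cong (k ℕ.+_) (ℕ.+-identityʳ k)) (toℕ<n a))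
  edge : ∀ {a b : Fin (2 ℕ.* k)} → a ≢ b → ∣ toℕ a - toℕ b ∣ ≡ k → antiwebAdj (2 ℕ.* k) k a b ≡ true
  edge {a} {b} a≢b d≡k = antiweb-true {k = k} {a} {b} a≢b (ℕ.≤-reflexive (≡.sym d≡k))
    (ℕ.≤-reflexive (trans d≡k (≡.sym (trans (ℕ.m+n∸m≡n k (k ℕ.+ 0)) (ℕ.+-identityʳ k)))))
  adjacent : ∀ {a b : Fin (2 ℕ.* k)} {j : Fin k} → a ≢ b →
    toℕ a ≡ toℕ j ⊎ toℕ a ≡ toℕ j ℕ.+ k → toℕ b ≡ toℕ j ⊎ toℕ b ≡ toℕ j ℕ.+ k →
    antiwebAdj (2 ℕ.* k) k a b ≡ true
  adjacent a≢b (inj₁ e) (inj₁ e′) = contradiction (toℕ-injective (trans e (≡.sym e′))) a≢b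
  adjacent a≢b (inj₂ e) (inj₂ e′) = contradiction (toℕ-injective (trans e (≡.sym e′))) a≢b
  adjacent a≢b (inj₁ e) (inj₂ e′) = edge a≢b (∣-∣-≡ (trans e′ (cong (ℕ._+ k) (≡.sym e))))
  adjacent {a} {b} a≢b (inj₂ e) (inj₁ e′) =
    edge a≢b (trans (ℕ.∣-∣-comm (toℕ a) (toℕ b)) (∣-∣-≡ (trans e (cong (ℕ._+ k) (≡.sym e′)))))

-- A^2_6 is the complement of the 6-cycle, that is, the prism; its two triangles are the even and
-- the odd nodes.
prism-partition : CliquePartition 6 2
prism-partition = record
  { r = 2 ; colour = side
  ; colour-adj = λ {a} {b} → from-yes (all? λ a → all? λ b →
      ¬? (a ≟ b) →-dec ((side a ≟ side b) →-dec (antiwebAdj 6 2 a b Bool.≟ true))) a b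
  ; stable = initial 2 ; is-stable = initial-stable 2 ℕ.≤-refl ; size≡r = refl }
  where
  side : Fin 6 → Fin 2
  side a = fromℕ< (m%n<n (toℕ a) 2)

-- For `k ≥ 2` the position of `m` relative to `2k` decides: below it there are no edges, at `2k`
-- there is a matching, at `2k + 1` an odd hole. Beyond that a claw exists if `k ≥ 3`; for `k = 2`
-- the prism with `m = 6` is an exception before the complement of P₆ appears at `m = 7`.
antiweb-case : ∀ m k → 1 ℕ.≤ m → 1 ℕ.≤ k → AntiwebCase m k
antiweb-case m (suc zero) m≥1 _ = partitioned (complete-partition m≥1)
antiweb-case m k@(suc (suc k′)) m≥1 _ with ℕ.<-cmp m (2 ℕ.* k)
... | tri< m<2k _ _ = partitioned (edgeless-partition m<2k)
... | tri≈ _ refl _ = partitioned (matching-partition k)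
... | tri> _ _ m>2k with ℕ.m≤n⇒m<n∨m≡n m>2k
... | inj₂ refl = odd-hole (s≤s (s≤s z≤n)) refl
... | inj₁ m>2k+1 with k′
... | suc _ = claw (s≤s (s≤s (s≤s z≤n))) m>2k+1
... | zero with ℕ.m≤n⇒m<n∨m≡n m>2k+1
... | inj₂ refl = partitioned prism-partition
... | inj₁ m>6  = co-P₆ refl m>6

-- Cliques and odd holes as joined antiwebs.

cliqueJoin : (G : Graph n) (Q : Fin n → Bool) → IsClique G Q → JoinedAntiweb G
cliqueJoin G Q clique = record
  { t = 0 ; m = λ () ; k = λ () ; m≥1 = λ () ; k≥1 = λ () ; αp = λ () ; isα = λ ()
  ; q = size Q ; emb = λ { (inj₂ c) → enum Q c }
  ; emb-inj = λ { {inj₂ c} {inj₂ d} e → cong inj₂ (enum-injective Q e) }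
  ; emb-antiweb = λ () ; emb-across = λ () ; emb-AQ = λ ()
  ; emb-Q = λ c d c≢d → clique _ _ (c≢d ∘ enum-injective Q) (enum-∈ Q c) (enum-∈ Q d) }

position-injective : ∀ k → Injective _≡_ _≡_ (position k)
position-injective k {a} {b} e =
  trans (≡.sym (label-position k a)) (trans (cong (label k) e) (label-position k b))

label-injective : ∀ k → Injective _≡_ _≡_ (label k)
label-injective k {a} {b} e =
  trans (≡.sym (position-label k a)) (trans (cong (position k) e) (position-label k b))

-- A join of one antiweb with the empty clique. The predecessor of `k` is passed along because the
-- record stores the stability number minus one.
holeJoin : (G : Graph n) (C : OddHole G) → let open OddHole C in ∀ k′ → k ≡ suc k′ → JoinedAntiweb G
holeJoin G C k′ refl = record
  { t = 1 ; m = λ _ → suc (2 ℕ.* k) ; k = λ _ → k ; m≥1 = λ _ → s≤s z≤n ; k≥1 = λ _ → s≤s z≤n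
  ; αp = λ _ → k′ ; isα = λ _ → α-odd k (s≤s z≤n)
  ; q = 0 ; emb = λ { (inj₁ (_ , a)) → node (position k a) }
  ; emb-inj = λ { {inj₁ (zero , a)} {inj₁ (zero , b)} e →
      cong (λ c → inj₁ (zero , c)) (position-injective k (node-inj e)) }
  ; emb-antiweb = λ _ a b a≢b →
      trans (chordless _ _ (a≢b ∘ position-injective k)) (cycle≡antiweb k a≢b)
  ; emb-across = λ { zero zero _ _ 0≢0 → contradiction refl 0≢0 }
  ; emb-AQ = λ _ _ () ; emb-Q = λ () }
  where open OddHole C

ASTAB*⊆HSTAB : ∀ {G : Graph n} {x} → InASTAB* G x → InHSTAB G x
ASTAB*⊆HSTAB {G = G} {x} (x≥0 , joined) = x≥0 , clique , hole
  where
  clique : ∀ Q → IsClique G Q → xOf x Q ≤ 1ℚ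
  clique Q c = subst (_≤ 1ℚ)
    (trans (ℚ.+-identityˡ (Σℚ (size Q) (x ∘ enum Q))) (≡.sym (xOf-enum x Q))) (joined (cliqueJoin G Q c))
  hole : ∀ (C : OddHole G) →
    Σℚ (suc (2 ℕ.* OddHole.k C)) (λ a → x (OddHole.node C a)) ≤ (ℤ.+ OddHole.k C) / 1
  hole C = go (ℕ.pred k) (≡.sym (ℕ.suc-pred k {{ℕ.>-nonZero (ℕ.<⇒≤ k≥2)}}))
    where
    open OddHole C
    go : ∀ k′ → k ≡ suc k′ → Σℚ (suc (2 ℕ.* k)) (λ a → x (node a)) ≤ (ℤ.+ k) / 1
    go k′ refl = subst₂ _≤_
      -- The joined constraint runs through the hole in antiweb order, the hole inequality in cyclic
      -- order.
      (≡.sym (Σ-permute (λ a → x (node a)) (visit-permutation k)))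
      (ℕ→ℚ≡/1 k)
      (recip-≤1⁻¹ k′ (subst (_≤ 1ℚ)
        (trans (ℚ.+-identityʳ (s + 0ℚ)) (ℚ.+-identityʳ s)) (joined (holeJoin G C k′ refl))))
      where s = ((ℤ.+ 1) / suc k′) * Σℚ (suc (2 ℕ.* k)) (λ a → x (node (position k a)))

-- Meeting edges of a multigraph.

Endpoint : Fin h → Fin h × Fin h → Set
Endpoint v e = v ≡ proj₁ e ⊎ v ≡ proj₂ e

Meet : Fin h × Fin h → Fin h × Fin h → Set
Meet e f = ∃ λ v → Endpoint v e × Endpoint v f

share⇒Meet : ∀ {e f : Fin h × Fin h} → shareB e f ≡ true → Meet e f
share⇒Meet {e = u , v} {u′ , v′} s with u ≟ u′ | u ≟ v′ | v ≟ u′ | v ≟ v′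
... | yes p | _     | _     | _     = u , inj₁ refl , inj₁ p
... | no _  | yes p | _     | _     = u , inj₁ refl , inj₂ p
... | no _  | no _  | yes p | _     = v , inj₂ refl , inj₁ p
... | no _  | no _  | no _  | yes p = v , inj₂ refl , inj₂ p

Meet⇒share : ∀ {e f : Fin h × Fin h} → Meet e f → shareB e f ≡ true
Meet⇒share {e = u , v} {u′ , v′} (w , p , q) with u ≟ u′ | u ≟ v′ | v ≟ u′ | v ≟ v′ | p | q
... | yes _ | _     | _     | _     | _         | _         = refl
... | no _  | yes _ | _     | _     | _         | _         = refl
... | no _  | no _  | yes _ | _     | _         | _         = refl
... | no _  | no _  | no _  | yes _ | _         | _         = refl
... | no ¬p | _     | _     | _     | inj₁ refl | inj₁ refl = contradiction refl ¬p
... | _     | no ¬p | _     | _     | inj₁ refl | inj₂ refl = contradiction refl ¬p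
... | _     | _     | no ¬p | _     | inj₂ refl | inj₁ refl = contradiction refl ¬p
... | _     | _     | _     | no ¬p | inj₂ refl | inj₂ refl = contradiction refl ¬p

-- The source of the pigeonhole arguments below: edges meeting `e` are distributed over its two
-- ends, and those at the same end meet each other.
Meet-ends : ∀ {e f : Fin h × Fin h} → Meet e f → Endpoint (proj₁ e) f ⊎ Endpoint (proj₂ e) f
Meet-ends (_ , inj₁ refl , q) = inj₁ q
Meet-ends (_ , inj₂ refl , q) = inj₂ q

-- Two of the three leaves would share an end of `e`.
no-claw : ∀ {e f₀ f₁ f₂ : Fin h × Fin h} → Meet e f₀ → Meet e f₁ → Meet e f₂ →
  ¬ Meet f₀ f₁ → ¬ Meet f₀ f₂ → ¬ Meet f₁ f₂ → ⊥
no-claw {h} {e} m₀ m₁ m₂ a b c = go (Meet-ends m₀) (Meet-ends m₁) (Meet-ends m₂)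
  where
  go : Endpoint _ _ ⊎ Endpoint _ _ → Endpoint _ _ ⊎ Endpoint _ _ → Endpoint _ _ ⊎ Endpoint _ _ → ⊥
  go (inj₁ p) (inj₁ q) _        = a (_ , p , q)
  go (inj₂ p) (inj₂ q) _        = a (_ , p , q)
  go (inj₁ p) _        (inj₁ r) = b (_ , p , r)
  go (inj₂ p) _        (inj₂ r) = b (_ , p , r)
  go _        (inj₁ q) (inj₁ r) = c (_ , q , r)
  go _        (inj₂ q) (inj₂ r) = c (_ , q , r)

-- Cyclically consecutive edges are disjoint, so they would have to alternate between the two ends
-- of `e`, which a cycle of odd length does not allow.
no-5-wheel : ∀ {e f₀ f₁ f₂ f₃ f₄ : Fin h × Fin h} →
  Meet e f₀ → Meet e f₁ → Meet e f₂ → Meet e f₃ → Meet e f₄ →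
  ¬ Meet f₀ f₁ → ¬ Meet f₁ f₂ → ¬ Meet f₂ f₃ → ¬ Meet f₃ f₄ → ¬ Meet f₄ f₀ → ⊥
no-5-wheel m₀ m₁ m₂ m₃ m₄ a b c d e
  with Meet-ends m₀ | Meet-ends m₁ | Meet-ends m₂ | Meet-ends m₃ | Meet-ends m₄
... | inj₁ p | inj₁ q | _      | _      | _      = a (_ , p , q)
... | inj₂ p | inj₂ q | _      | _      | _      = a (_ , p , q)
... | _      | inj₁ p | inj₁ q | _      | _      = b (_ , p , q)
... | _      | inj₂ p | inj₂ q | _      | _      = b (_ , p , q)
... | _      | _      | inj₁ p | inj₁ q | _      = c (_ , p , q)
... | _      | _      | inj₂ p | inj₂ q | _      = c (_ , p , q)
... | _      | _      | _      | inj₁ p | inj₁ q = d (_ , p , q)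
... | _      | _      | _      | inj₂ p | inj₂ q = d (_ , p , q)
... | inj₁ p | _      | _      | _      | inj₁ q = e (_ , q , p)
... | inj₂ p | _      | _      | _      | inj₂ q = e (_ , q , p)

Endpoint-exhaust : ∀ {e : Fin h × Fin h} {u v w} → Endpoint u e → Endpoint v e → u ≢ v →
  Endpoint w e → w ≡ u ⊎ w ≡ v
Endpoint-exhaust (inj₁ refl) (inj₁ refl) u≢v _           = contradiction refl u≢v
Endpoint-exhaust (inj₂ refl) (inj₂ refl) u≢v _           = contradiction refl u≢v
Endpoint-exhaust (inj₁ refl) (inj₂ refl) _   w           = w
Endpoint-exhaust (inj₂ refl) (inj₁ refl) _   (inj₁ refl) = inj₂ refl
Endpoint-exhaust (inj₂ refl) (inj₁ refl) _   (inj₂ refl) = inj₁ refl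

-- The disjoint edges `d` and `e` occupy different ends of `z`. The end `v` lies on `f` and
-- therefore not on `e`, so it is the end that `d` occupies.
Endpoint-transfer : ∀ {z d e f : Fin h × Fin h} {v} → Meet z d → Meet z e → ¬ Meet d e → ¬ Meet e f →
  Endpoint v z → Endpoint v f → Endpoint v d
Endpoint-transfer zd ze ¬de ¬ef v∈z v∈f with Meet-ends zd | Meet-ends ze | v∈z
... | inj₁ p | inj₁ q | _         = contradiction (_ , p , q) ¬de
... | inj₂ p | inj₂ q | _         = contradiction (_ , p , q) ¬de
... | inj₁ p | inj₂ q | inj₁ refl = p
... | inj₁ p | inj₂ q | inj₂ refl = contradiction (_ , q , v∈f) ¬ef
... | inj₂ p | inj₁ q | inj₁ refl = contradiction (_ , q , v∈f) ¬ef
... | inj₂ p | inj₁ q | inj₂ refl = p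

-- d, e and f each join a to b; as e is disjoint from d and f, the latter are parallel, yet c
-- meets f and not d.
no-co-P₆ : ∀ {a b c d e f : Fin h × Fin h} →
  ¬ Meet a b → ¬ Meet c d → ¬ Meet d e → ¬ Meet e f →
  Meet a d → Meet a e → Meet a f → Meet b d → Meet b e → Meet b f → Meet c f → ⊥
no-co-P₆ ¬ab ¬cd ¬de ¬ef ad ae (u , u∈a , u∈f) bd be (v , v∈b , v∈f) (w , w∈c , w∈f) =
  ¬cd (w , w∈c , w∈d)
  where
  w∈d : Endpoint w _
  w∈d with Endpoint-exhaust u∈f v∈f (λ { refl → ¬ab (u , u∈a , v∈b) }) w∈f
  ... | inj₁ refl = Endpoint-transfer ad ae ¬de ¬ef u∈a w∈f
  ... | inj₂ refl = Endpoint-transfer bd be ¬de ¬ef v∈b w∈f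

-- The heaviest clique of a partition.

argmax : ∀ {r} → Fin r → (f : Fin r → ℚ) → ∃ λ j → ∀ i → f i ≤ f j
argmax {suc zero}      _ f = zero , λ { zero → ℚ.≤-refl }
argmax {suc r@(suc _)} _ f with argmax {r} zero (f ∘ suc)
... | j , max with ℚ.≤-total (f zero) (f (suc j))
... | inj₁ le = suc j , λ { zero → le ; (suc i) → max i }
... | inj₂ ge = zero , λ { zero → ℚ.≤-refl ; (suc i) → ℚ.≤-trans (max i) ge }

sumL-++ : ∀ (x : Fin n → ℚ) K L → sumL x (K ++ L) ≡ sumL x K + sumL x L
sumL-++ x []      L = ≡.sym (ℚ.+-identityˡ (sumL x L))
sumL-++ x (v ∷ K) L = trans (cong (x v +_) (sumL-++ x K L)) (≡.sym (ℚ.+-assoc (x v) (sumL x K) (sumL x L)))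

sumL-map : ∀ {m} (x : Fin n → ℚ) (g : Fin m → Fin n) L → sumL x (map g L) ≡ sumL (x ∘ g) L
sumL-map x g []      = refl
sumL-map x g (v ∷ L) = cong (x (g v) +_) (sumL-map x g L)

sumL-tabulate : ∀ {m} (x : Fin n → ℚ) (g : Fin m → Fin n) → sumL x (tabulate g) ≡ Σℚ m (x ∘ g)
sumL-tabulate {m = zero}  x g = refl
sumL-tabulate {m = suc m} x g = cong (x (g zero) +_) (sumL-tabulate x (g ∘ suc))

sumL-concat : ∀ {t} (x : Fin n → ℚ) (g : Fin t → List (Fin n)) →
  sumL x (concat (tabulate g)) ≡ Σℚ t (λ i → sumL x (g i))
sumL-concat {t = zero}  x g = refl
sumL-concat {t = suc t} x g = trans (sumL-++ x (g zero) (concat (tabulate (g ∘ suc))))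
  (cong (sumL x (g zero) +_) (sumL-concat x (g ∘ suc)))

sumL-nonneg : ∀ {x : Fin n → ℚ} → (∀ v → 0ℚ ≤ x v) → ∀ L → 0ℚ ≤ sumL x L
sumL-nonneg x≥0 []      = ℚ.≤-refl
sumL-nonneg x≥0 (v ∷ L) = ℚ.+-mono-≤ (x≥0 v) (sumL-nonneg x≥0 L)

class : ∀ {m r} → (Fin m → Fin r) → Fin r → List (Fin m) → List (Fin m)
class c j = filter (λ a → c a ≟ j)

-- A new entry lengthens the class of its own colour and no other.
sumL-class : ∀ {m r} (y : Fin m → ℚ) (c : Fin m → Fin r) L →
  Σℚ r (λ j → sumL y (class c j L)) ≡ sumL y L
sumL-class {r = r} y c []      = Σ-zero r (λ _ → refl)
sumL-class y c (a ∷ L) = trans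
  (Σ-update _ (λ j → sumL y (class c j L)) (c a) (y a) at off) (cong (y a +_) (sumL-class y c L))
  where
  at : sumL y (class c (c a) (a ∷ L)) ≡ y a + sumL y (class c (c a) L)
  at with c a ≟ c a
  ... | yes _ = refl
  ... | no ≢  = contradiction refl ≢
  off : ∀ j → j ≢ c a → sumL y (class c j (a ∷ L)) ≡ sumL y (class c j L)
  off j j≢ with c a ≟ j
  ... | yes e = contradiction (≡.sym e) j≢
  ... | no _  = refl

-- Combines what is known of single entries (their colour) with what is known of pairs
-- (distinctness) into adjacency.
AllPairs-refine : ∀ {A : Set} {P : A → Set} {R Q : A → A → Set} → (∀ {a b} → P a → P b → R a b → Q a b) →
  ∀ {L} → All P L → AllPairs R L → AllPairs Q L
AllPairs-refine f []       []       = []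
AllPairs-refine f (p ∷ ps) (r ∷ rs) = All.zipWith (λ (q , r) → f p q r) (ps , r) ∷ AllPairs-refine f ps rs

-- The total weight is at most `r` times the heaviest class, and `r` is at most the stability number
-- `p + 1`; nonnegativity of `y` permits this enlargement of the factor. The clique is a list, so
-- that the cliques of several antiwebs can be concatenated.
partition-bound : ∀ {m k p} → 1 ℕ.≤ m → CliquePartition m k → IsAlpha (antiwebAdj m k) (suc p) →
  (y : Fin m → ℚ) → (∀ a → 0ℚ ≤ y a) →
  ∃ λ L → AllPairs (λ a b → antiwebAdj m k a b ≡ true) L × ((ℤ.+ 1) / suc p) * Σℚ m y ≤ sumL y L
partition-bound {m} {k} {p} m≥1 P isα y y≥0 = best , clique , recip-≤ p bound
  where
  open CliquePartition P
  part : Fin r → List (Fin m)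
  part j = class colour j (allFin m)
  top : ∃ λ j → ∀ i → sumL y (part i) ≤ sumL y (part j)
  -- The colour of node 0 shows that there is a class to choose from.
  top = argmax (colour (fromℕ< m≥1)) (λ j → sumL y (part j))
  j = proj₁ top
  best = part j
  clique : AllPairs (λ a b → antiwebAdj m k a b ≡ true) best
  clique = AllPairs-refine (λ p q a≢b → colour-adj a≢b (trans p (≡.sym q)))
    (All.all-filter (λ a → colour a ≟ j) (allFin m))
    (AllPairs.filter⁺ (λ a → colour a ≟ j) (AllPairs.tabulate⁺ id))
  bound : Σℚ m y ≤ ℕ→ℚ (suc p) * sumL y best
  bound = ℚ.≤-trans
    (ℚ.≤-reflexive (≡.sym (trans (sumL-class y colour (allFin m)) (sumL-tabulate y id))))
    (ℚ.≤-trans (Σ-≤-const r (λ i → sumL y (part i)) (sumL y best) (proj₂ top))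
      (ℚ.*-monoʳ-≤-nonNeg (sumL y best) {{nonNegative (sumL-nonneg y≥0 best)}}
        (ℕ→ℚ-mono (subst (ℕ._≤ suc p) size≡r (proj₂ isα stable is-stable)))))

∀⊎∃ : ∀ {t} {P R : Fin t → Set} → (∀ i → P i ⊎ R i) → (∀ i → P i) ⊎ ∃ R
∀⊎∃ {zero}  f = inj₁ λ ()
∀⊎∃ {suc t} f with f zero | ∀⊎∃ (f ∘ suc)
... | inj₂ r | _            = inj₂ (zero , r)
... | inj₁ p | inj₂ (i , r) = inj₂ (suc i , r)
... | inj₁ p | inj₁ ps      = inj₁ λ { zero → p ; (suc i) → ps i }

Σ-single : ∀ {t} (f : Fin t → ℚ) i → (∀ j → j ≡ i) → Σℚ t f ≡ f i
Σ-single {suc zero}    f zero _ = ℚ.+-identityʳ (f zero)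
Σ-single {suc (suc t)} f i all with () ← trans (all zero) (≡.sym (all (suc zero)))

-- Using the inequalities of HSTAB.

clique-inequality : ∀ {G : Graph n} {x} → InHSTAB G x → ∀ {L} → AllPairs (Adjacent G) L → sumL x L ≤ 1ℚ
clique-inequality {G = G} {x} (_ , clique , _) {L} c = subst (_≤ 1ℚ)
  (xOf-member x (AllPairs.map (Adjacent⇒≢ G) c)) (clique (member L) (member-clique G c))

-- Read in the order of `label`, the copy of the antiweb is an odd hole of `G`; permuting the sum
-- restores the antiweb order.
hole-inequality : ∀ {G : Graph n} {x} → InHSTAB G x → ∀ {m k} → 2 ℕ.≤ k → m ≡ suc (2 ℕ.* k) →
  (φ : Fin m → Fin n) → Injective _≡_ _≡_ φ →
  (∀ a b → a ≢ b → adj G (φ a) (φ b) ≡ antiwebAdj m k a b) → Σℚ m (x ∘ φ) ≤ ℕ→ℚ k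
hole-inequality {G = G} {x} (_ , _ , hole) {m} {k} k≥2 refl φ φ-inj φ-adj = subst₂ _≤_
  (trans (Σ-permute (x ∘ φ ∘ label k) (visit-permutation k))
    (Σ-cong m (λ a → cong (x ∘ φ) (label-position k a))))
  (≡.sym (ℕ→ℚ≡/1 k)) (hole C)
  where
  C : OddHole G
  C = record
    { k = k ; k≥2 = k≥2 ; node = φ ∘ label k ; node-inj = label-injective k ∘ φ-inj
    ; chordless = λ a b a≢b → trans (φ-adj _ _ (a≢b ∘ label-injective k))
        (trans (≡.sym (cycle≡antiweb k (a≢b ∘ label-injective k)))
          (cong₂ (cycleAdj m) (position-label k a) (position-label k b))) }

-- Antiwebs inside a line graph.

module LineGraph {n : ℕ} {G : Graph n} {h : ℕ} (ends : Fin n → Fin h × Fin h)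
  (adj≡share : ∀ e f → e ≢ f → adj G e f ≡ shareB (ends e) (ends f)) where

  Adjacent⇒Meet : ∀ {e f} → Adjacent G e f → Meet (ends e) (ends f)
  Adjacent⇒Meet {e} {f} a = share⇒Meet (trans (≡.sym (adj≡share e f (Adjacent⇒≢ G a))) a)

  module Antiweb {m k : ℕ} (φ : Fin m → Fin n) (φ-inj : Injective _≡_ _≡_ φ)
    (φ-adj : ∀ a b → a ≢ b → adj G (φ a) (φ b) ≡ antiwebAdj m k a b) where

    edge : ∀ {i} → i ℕ.< m → Fin h × Fin h
    edge i<m = ends (φ (fromℕ< i<m))

    dist-fromℕ< : ∀ {i j} (p : i ℕ.< m) (q : j ℕ.< m) →
      ∣ toℕ (fromℕ< p) - toℕ (fromℕ< q) ∣ ≡ ∣ i - j ∣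
    dist-fromℕ< p q = cong₂ ∣_-_∣ (toℕ-fromℕ< p) (toℕ-fromℕ< q)

    distinct : ∀ {i j} (p : i ℕ.< m) (q : j ℕ.< m) → i ≢ j → fromℕ< p ≢ fromℕ< q
    distinct p q i≢j e = i≢j (trans (≡.sym (toℕ-fromℕ< p)) (trans (cong toℕ e) (toℕ-fromℕ< q)))

    meet : ∀ {i j} (p : i ℕ.< m) (q : j ℕ.< m) → i ≢ j →
      k ℕ.≤ ∣ i - j ∣ → ∣ i - j ∣ ℕ.≤ m ∸ k → Meet (edge p) (edge q)
    meet p q i≢j lo hi = Adjacent⇒Meet (trans (φ-adj _ _ a≢b) (antiweb-true {k = k} {fromℕ< p} {fromℕ< q} a≢b
      (subst (k ℕ.≤_) (≡.sym (dist-fromℕ< p q)) lo)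
      (subst (ℕ._≤ m ∸ k) (≡.sym (dist-fromℕ< p q)) hi)))
      where a≢b = distinct p q i≢j

    apart : ∀ {i j} (p : i ℕ.< m) (q : j ℕ.< m) → i ≢ j →
      ∣ i - j ∣ ℕ.< k ⊎ m ∸ k ℕ.< ∣ i - j ∣ → ¬ Meet (edge p) (edge q)
    apart {i} {j} p q i≢j far meets = [ (λ lt → ℕ.<⇒≱ lt lo) , (λ lt → ℕ.<⇒≱ lt hi) ]′ far
      where
      a≢b = distinct p q i≢j
      bounds : k ℕ.≤ ∣ i - j ∣ × ∣ i - j ∣ ℕ.≤ m ∸ k
      bounds = subst (λ d → k ℕ.≤ d × d ℕ.≤ m ∸ k) (dist-fromℕ< p q) (antiweb-true⁻¹ {k = k} {fromℕ< p} {fromℕ< q}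
        (trans (≡.sym (φ-adj _ _ a≢b)) (trans (adj≡share _ _ (a≢b ∘ φ-inj)) (Meet⇒share meets))))
      lo = proj₁ bounds
      hi = proj₂ bounds

    -- The centre is 0 and the leaves are `k`, `k+1`, `k+2`. Their distances from 0 are allowed
    -- because `m ≥ 2k + 2` gives `k + 2 ≤ m - k`, and among themselves they differ by at most 2,
    -- less than `k`.
    no-antiweb-claw : 3 ℕ.≤ k → ¬ (2 ℕ.+ 2 ℕ.* k ℕ.≤ m)
    no-antiweb-claw k≥3 le = no-claw {e = edge p} (centre 0 z≤n) (centre 1 (s≤s z≤n)) (centre 2 ℕ.≤-refl)
      (leaves 0 1 z≤n (s≤s z≤n) (λ ()) (ℕ.<⇒≤ k≥3))
      (leaves 0 2 z≤n ℕ.≤-refl (λ ()) k≥3)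
      (leaves 1 2 (s≤s z≤n) ℕ.≤-refl (λ ()) (ℕ.<⇒≤ k≥3))
      where
      p : 0 ℕ.< m
      p = ℕ.≤-trans (s≤s z≤n) le
      k+2≤m∸k : k ℕ.+ 2 ℕ.≤ m ∸ k
      k+2≤m∸k = subst (ℕ._≤ m ∸ k) (trans (ℕ.+-∸-assoc 2 (ℕ.m≤m+n k (k ℕ.+ 0)))
        (trans (cong (2 ℕ.+_) (trans (ℕ.m+n∸m≡n k (k ℕ.+ 0)) (ℕ.+-identityʳ k))) (ℕ.+-comm 2 k)))
        (ℕ.∸-monoˡ-≤ k le)
      leaf : ∀ {i} → i ℕ.≤ 2 → k ℕ.+ i ℕ.< m
      leaf {i} i≤2 = ℕ.≤-trans (s≤s (ℕ.≤-trans (ℕ.+-monoʳ-≤ k i≤2) (ℕ.≤-reflexive (ℕ.+-comm k 2))))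
        (ℕ.≤-trans (s≤s (s≤s (ℕ.≤-trans (ℕ.+-monoˡ-≤ k (ℕ.<⇒≤ (ℕ.<⇒≤ k≥3)))
          (ℕ.≤-reflexive (cong (k ℕ.+_) (≡.sym (ℕ.+-identityʳ k))))))) le)
      centre : ∀ i (i≤2 : i ℕ.≤ 2) → Meet (edge p) (edge (leaf i≤2))
      centre i i≤2 = meet p (leaf i≤2) (ℕ.<⇒≢ (ℕ.≤-trans (ℕ.≤-trans (s≤s z≤n) k≥3) (ℕ.m≤m+n k i)))
        (ℕ.m≤m+n k i) (ℕ.≤-trans (ℕ.+-monoʳ-≤ k i≤2) k+2≤m∸k)
      leaves : ∀ i j (p : i ℕ.≤ 2) (q : j ℕ.≤ 2) → i ≢ j → ∣ i - j ∣ ℕ.< k → ¬ Meet (edge (leaf p)) (edge (leaf q))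
      leaves i j p q i≢j lt = apart (leaf p) (leaf q) (i≢j ∘ ℕ.+-cancelˡ-≡ k i j)
        (inj₁ (subst (ℕ._< k) (≡.sym (ℕ.∣m+n-m+o∣≡∣n-o∣ k i j)) lt))

    -- Among the nodes 0 to 5 exactly the consecutive ones are nonadjacent: the largest distance 5
    -- is still at most `m - 2`, which is where `m ≥ 7` enters.
    no-antiweb-co-P₆ : k ≡ 2 → ¬ (7 ℕ.≤ m)
    no-antiweb-co-P₆ k≡2 7≤m = no-co-P₆
      (next 0) (next 2) (next 3) (next 4)
      (far 0 3) (far 0 4) (far 0 5) (far 1 3) (far 1 4) (far 1 5) (far 2 5)
      where
      node : ∀ i {i<7 : T (i ℕ.<ᵇ 7)} → i ℕ.< m
      node i {i<7} = ℕ.≤-trans (ℕ.<ᵇ⇒< i 7 i<7) 7≤m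
      next : ∀ i {p : T (i ℕ.<ᵇ 7)} {q : T (suc i ℕ.<ᵇ 7)} → ¬ Meet (edge (node i {p})) (edge (node (suc i) {q}))
      next i {p} {q} = apart (node i {p}) (node (suc i) {q}) (ℕ.<⇒≢ ℕ.≤-refl)
        (inj₁ (subst₂ ℕ._<_ (≡.sym (∣-∣-≡ {i} (ℕ.+-comm 1 i))) (≡.sym k≡2) ℕ.≤-refl))
      far : ∀ i j {p : T (i ℕ.<ᵇ 7)} {q : T (j ℕ.<ᵇ 7)} {lt : T (i ℕ.<ᵇ j)}
        {lo : T (2 ℕ.≤ᵇ ∣ i - j ∣)} {hi : T (∣ i - j ∣ ℕ.≤ᵇ 5)} → Meet (edge (node i {p})) (edge (node j {q}))
      far i j {p} {q} {lt} {lo} {hi} = meet (node i {p}) (node j {q}) (ℕ.<⇒≢ (ℕ.<ᵇ⇒< i j lt))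
        (subst (ℕ._≤ ∣ i - j ∣) (≡.sym k≡2) (ℕ.≤ᵇ⇒≤ 2 _ lo))
        (ℕ.≤-trans (ℕ.≤ᵇ⇒≤ _ 5 hi) (subst (λ k → 5 ℕ.≤ m ∸ k) (≡.sym k≡2) (ℕ.∸-monoˡ-≤ 2 7≤m)))

    -- If `k ≥ 3`, the nodes 0, 1, 2 are pairwise nonadjacent and form a claw with centre `z`. If
    -- `k = 2`, the nonadjacent pairs form the 5-cycle 0, 1, 2, 3, 4, closed by the distance 4 >
    -- `m - k`, and `no-5-wheel` applies.
    no-dominated-hole : 2 ℕ.≤ k → m ≡ suc (2 ℕ.* k) → ∀ {z} → ¬ (∀ a → Adjacent G z (φ a))
    no-dominated-hole k≥2 m≡ {z} dom = [ large , small ]′ (ℕ.m≤n⇒m<n∨m≡n k≥2)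
      where
      node : ∀ i {i<5 : T (i ℕ.<ᵇ 5)} → i ℕ.< m
      node i {i<5} = ℕ.≤-trans (ℕ.<ᵇ⇒< i 5 i<5) (subst (5 ℕ.≤_) (≡.sym m≡) (s≤s (ℕ.*-monoʳ-≤ 2 k≥2)))
      dominate : ∀ i {p : T (i ℕ.<ᵇ 5)} → Meet (ends z) (edge (node i {p}))
      dominate i = Adjacent⇒Meet (dom _)
      near : ∀ i j {p : T (i ℕ.<ᵇ 5)} {q : T (j ℕ.<ᵇ 5)} → i ≢ j → ∣ i - j ∣ ℕ.< k ⊎ m ∸ k ℕ.< ∣ i - j ∣ →
        ¬ Meet (edge (node i {p})) (edge (node j {q}))
      near i j {p} {q} = apart (node i {p}) (node j {q})
      large : ¬ (3 ℕ.≤ k)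
      large k≥3 = no-claw (dominate 0) (dominate 1) (dominate 2)
        (near 0 1 (λ ()) (inj₁ k≥2)) (near 0 2 (λ ()) (inj₁ k≥3)) (near 1 2 (λ ()) (inj₁ k≥2))
      small : 2 ≢ k
      small 2≡k = no-5-wheel (dominate 0) (dominate 1) (dominate 2) (dominate 3) (dominate 4)
        (near 0 1 (λ ()) (inj₁ k≥2)) (near 1 2 (λ ()) (inj₁ k≥2)) (near 2 3 (λ ()) (inj₁ k≥2))
        (near 3 4 (λ ()) (inj₁ k≥2)) (near 4 0 (λ ()) (inj₂ m∸k<4))
        where
        m∸k<4 : m ∸ k ℕ.< 4
        m∸k<4 = ℕ.≤-reflexive (cong suc (trans (cong (_∸ k) m≡) (trans (2k+1∸k k) (cong suc (≡.sym 2≡k)))))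

    partition-or-hole : 1 ℕ.≤ m → 1 ℕ.≤ k → CliquePartition m k ⊎ (2 ℕ.≤ k × m ≡ suc (2 ℕ.* k))
    partition-or-hole m≥1 k≥1 with antiweb-case m k m≥1 k≥1
    ... | partitioned P   = inj₁ P
    ... | odd-hole k≥2 m≡ = inj₂ (k≥2 , m≡)
    ... | claw k≥3 le     = ⊥-elim (no-antiweb-claw k≥3 le)
    ... | co-P₆ k≡2 7≤m   = ⊥-elim (no-antiweb-co-P₆ k≡2 7≤m)

  -- Joined antiweb constraints at points of HSTAB.

  joined-bound : ∀ {x} → InHSTAB G x → (J : JoinedAntiweb G) → joinedLHS J x ≤ 1ℚ
  joined-bound {x} H J =
    [ all-partitioned , (λ { (i , k≥2 , m≡) → one-hole i k≥2 m≡ }) ]′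
      (∀⊎∃ (λ i → Antiweb.partition-or-hole (φ i) (φ-injective i) (emb-antiweb i) (m≥1 i) (k≥1 i)))
    where
    open JoinedAntiweb J
    φ : ∀ i → Fin (m i) → Fin n
    φ i a = emb (inj₁ (i , a))
    ψ : Fin q → Fin n
    ψ c = emb (inj₂ c)
    φ-injective : ∀ i → Injective _≡_ _≡_ (φ i)
    φ-injective i e = pair-injective (emb-inj e)
      where
      pair-injective : ∀ {a b} → inj₁ {B = Fin q} (i , a) ≡ inj₁ (i , b) → a ≡ b
      pair-injective refl = refl
    term : Fin t → ℚ
    term i = ((ℤ.+ 1) / suc (αp i)) * Σℚ (m i) (x ∘ φ i)

    -- Each antiweb term is bounded by the weight of one clique of that antiweb. The join supplies
    -- all edges between parts, so these cliques and Q concatenate to a single clique.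
    all-partitioned : (∀ i → CliquePartition (m i) (k i)) → joinedLHS J x ≤ 1ℚ
    all-partitioned P = ℚ.≤-trans
      (ℚ.+-mono-≤ (Σ-mono-≤ t (λ i → proj₂ (proj₂ (choice i)))) (ℚ.≤-refl {Σℚ q (x ∘ ψ)}))
      (subst (_≤ 1ℚ) total (clique-inequality H clique))
      where
      choice : ∀ i → ∃ λ L → AllPairs (λ a b → antiwebAdj (m i) (k i) a b ≡ true) L × term i ≤ sumL (x ∘ φ i) L
      choice i = partition-bound (m≥1 i) (P i) (isα i) (x ∘ φ i) (proj₁ H ∘ φ i)
      part : Fin t → List (Fin n)
      part i = map (φ i) (proj₁ (choice i))
      total : sumL x (concat (tabulate part) ++ tabulate ψ) ≡
        Σℚ t (λ i → sumL (x ∘ φ i) (proj₁ (choice i))) + Σℚ q (x ∘ ψ)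
      total = trans (sumL-++ x (concat (tabulate part)) (tabulate ψ)) (cong₂ _+_
        (trans (sumL-concat x part) (Σ-cong t (λ i → sumL-map x (φ i) (proj₁ (choice i)))))
        (sumL-tabulate x ψ))
      part-clique : ∀ i → AllPairs (Adjacent G) (part i)
      part-clique i = AllPairs.map⁺ (AllPairs.map (λ {a} {b} e →
        trans (emb-antiweb i a b (antiweb-≢ e)) e) (proj₁ (proj₂ (choice i))))
        where
        antiweb-≢ : ∀ {a b} → antiwebAdj (m i) (k i) a b ≡ true → a ≢ b
        antiweb-≢ {a} e refl with a ≟ a
        antiweb-≢ () refl | yes _
        ... | no a≢a = a≢a refl
      clique : AllPairs (Adjacent G) (concat (tabulate part) ++ tabulate ψ)
      clique = AllPairs.++⁺
        (AllPairs.concat⁺ (All.tabulate⁺ part-clique) (AllPairs.tabulate⁺ λ {i} {j} i≢j →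
          All.map⁺ (All.universal (λ a → All.map⁺ (All.universal (λ b → emb-across i j a b i≢j) _)) _)))
        (AllPairs.tabulate⁺ (λ {c} {d} → emb-Q c d))
        (All.concat⁺ (All.tabulate⁺ λ i → All.map⁺ (All.universal (λ a → All.tabulate⁺ (emb-AQ i a)) _)))

    -- A node of another part would dominate the hole, so the constraint reduces to one term; the
    -- hole inequality bounds its sum by `k`, and the first `k` nodes, being stable, show that `k`
    -- is at most the stability number.
    one-hole : ∀ i → 2 ℕ.≤ k i → m i ≡ suc (2 ℕ.* k i) → joinedLHS J x ≤ 1ℚ
    one-hole i k≥2 m≡ = subst (_≤ 1ℚ) (≡.sym lhs≡) (recip-≤1 (αp i) (ℚ.≤-trans
      (hole-inequality H k≥2 m≡ (φ i) (φ-injective i) (emb-antiweb i)) (ℕ→ℚ-mono k≤α)))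
      where
      undominated : ∀ {z} → ¬ (∀ a → Adjacent G z (φ i a))
      undominated = Antiweb.no-dominated-hole (φ i) (φ-injective i) (emb-antiweb i) k≥2 m≡
      only : ∀ j → j ≡ i
      only j with j ≟ i
      ... | yes j≡i = j≡i
      -- Node 0 of part `j`, which exists by `m≥1`, would be adjacent to the whole hole.
      ... | no  j≢i = ⊥-elim (undominated (λ a → emb-across j i (fromℕ< (m≥1 j)) a j≢i))
      no-Q : ¬ Fin q
      no-Q c = undominated (λ a → trans (sym G _ _) (emb-AQ i a c))
      lhs≡ : joinedLHS J x ≡ term i
      lhs≡ = trans (cong₂ _+_ (Σ-single term i only) (Σ-zero q (λ c → ⊥-elim (no-Q c)))) (ℚ.+-identityʳ (term i))
      k≤α : k i ℕ.≤ suc (αp i)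
      k≤α = subst (ℕ._≤ suc (αp i))
        (size-initial (subst (k i ℕ.≤_) (≡.sym m≡) (ℕ.≤-trans (ℕ.m≤m+n (k i) _) (ℕ.n≤1+n _))))
        (proj₂ (isα i) (initial (k i)) (initial-stable (k i) ℕ.≤-refl))

  HSTAB⊆ASTAB* : ∀ {x} → InHSTAB G x → InASTAB* G x
  HSTAB⊆ASTAB* H = proj₁ H , joined-bound H

theorem5 : ∀ (n : ℕ) (G : Graph n) → IsLineGraph G →
    (JoinedAPerfect G → HPerfect G) × (HPerfect G → JoinedAPerfect G)
theorem5 n G (_ , ends , _ , adj≡share) =
    (λ P x → ASTAB*⊆HSTAB ∘ STAB⊆ASTAB* {G = G} , proj₂ (P x) ∘ HSTAB⊆ASTAB*)
  , (λ P x → STAB⊆ASTAB* {G = G} , proj₂ (P x) ∘ ASTAB*⊆HSTAB)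
  where open LineGraph {G = G} ends adj≡share
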